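{- For every fixed integer $s\ge 1$, as $n\to\infty$, $$\beta_s(n)=\log^{s}(n)+\gamma\, s\,\log^{s-1}(n)+O\!\left(\log^{s-2}(n)\right),$$ where $\beta_s(n)=\sum_{k\ge 0}(k)_s\,\frac{C_{n,k}}{n!}$ is the $s$th factorial moment of the number of cycles of a uniformly random permutation of $\{1,\dots,n\}$.
   Context: $S_n$ is the set of all $n!$ permutations of $\{1,\dots,n\}$, and $C_{n,k}$ is the number of permutations in $S_n$ with exactly $k$ cycles (fixed points count as cycles). $(k)_s=k(k-1)\cdots(k-s+1)$ is the falling factorial, with $(k)_0=1$. $\gamma=0.577\cdots$ is Euler's constant, $\log$ is the natural logarithm, and $\log^{j}(n)=(\log n)^j$ (with $j$ possibly negative). The implied constant in $O(\cdot)$ may depend on $s$. -}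

module Defs where

open import Data.Fin.Base using (Fin; toℕ; fromℕ<; finToFun)
open import Data.Fin.Properties as Finₚ using (toℕ<n; toℕ-fromℕ<)
open import Data.Integer.Base as ℤ using (ℤ; +_; -[1+_])
open import Data.List.Base using (List; allFin; deduplicate; filter; length; map)
open import Data.Nat.Base as ℕ using (ℕ; zero; suc; s≤s; z≤n; _!)
open import Data.Nat.Combinatorics using (_P_)
open import Data.Nat.GeneralisedArithmetic using (iterate)
open import Data.Nat.Induction using (<-rec)
import Data.Nat.Properties as ℕₚ
import Data.Integer.Properties as ℤₚ
open import Data.Product.Base using (∃; _×_; _,_; proj₁; proj₂)
open import Data.Rational.Base
open import Data.Rational.Properties
open import Data.Rational.Unnormalised.Base as ℚᵘ using (ℚᵘ; mkℚᵘ)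
import Data.Rational.Unnormalised.Properties as ℚᵘₚ
open import Data.Rational.Solver using (module +-*-Solver)
open import Data.Sum.Base using (inj₁; inj₂)
open import Function.Base using (_∘_)
open import Function.Definitions using (Bijective; Injective; Surjective)
open import Relation.Binary.PropositionalEquality
  using (_≡_; refl; sym; trans; cong; cong₂; subst; subst₂)
open import Relation.Nullary using (Dec; yes; no; _×-dec_; _→-dec_; contradiction)
open import Relation.Nullary.Decidable using (map′)

SameCycle : ∀ {n} → (Fin n → Fin n) → Fin n → Fin n → Set
SameCycle σ i j = ∃ λ k → iterate σ i k ≡ j

module _ {n} (σ : Fin n → Fin n) where

  iterate-+ : ∀ i a b → iterate σ i (a ℕ.+ b) ≡ iterate σ (iterate σ i a) b
  iterate-+ i zero    b = refl
  iterate-+ i (suc a) b = iterate-+ (σ i) a b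

  -- By the pigeonhole principle the first n iterates exhaust the orbit.
  private
    Bounded : Fin n → Fin n → ℕ → Set
    Bounded i j k =
      iterate σ i k ≡ j → ∃ λ (l : Fin n) → iterate σ i (toℕ l) ≡ j

    bounded : ∀ i j k → Bounded i j k
    bounded i j = <-rec (Bounded i j) step
      where
      step : ∀ k → (∀ {k′} → k′ ℕ.< k → Bounded i j k′) → Bounded i j k
      step k rec σᵏi≡j with k ℕₚ.<? n
      ... | yes k<n = fromℕ< k<n ,
                      trans (cong (iterate σ i) (toℕ-fromℕ< k<n)) σᵏi≡j
      ... | no k≮n with a , b , a<b , eq ←
                        Finₚ.pigeonhole (ℕₚ.n<1+n n) (iterate σ i ∘ toℕ {suc n}) =
        rec k′<k (trans same σᵏi≡j)
        where
        b≤k : toℕ b ℕ.≤ k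
        b≤k = ℕₚ.≤-trans (ℕ.s≤s⁻¹ (toℕ<n b)) (ℕₚ.≮⇒≥ k≮n)
        k′ : ℕ
        k′ = toℕ a ℕ.+ (k ℕ.∸ toℕ b)
        k′<k : k′ ℕ.< k
        k′<k = subst (k′ ℕ.<_) (ℕₚ.m+[n∸m]≡n b≤k) (ℕₚ.+-monoˡ-< (k ℕ.∸ toℕ b) a<b)
        same : iterate σ i k′ ≡ iterate σ i k
        same = trans (iterate-+ i (toℕ a) _)
              (trans (cong (λ x → iterate σ x (k ℕ.∸ toℕ b)) eq)
              (trans (sym (iterate-+ i (toℕ b) _))
                     (cong (iterate σ i) (ℕₚ.m+[n∸m]≡n b≤k))))

  sameCycle? : ∀ i j → Dec (SameCycle σ i j)
  sameCycle? i j =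
    map′ (λ (l , eq) → toℕ l , eq) (λ (k , eq) → bounded i j k eq)
         (Finₚ.any? λ l → iterate σ i (toℕ l) Finₚ.≟ j)

  bijective? : Dec (Bijective _≡_ _≡_ σ)
  bijective? = injective? ×-dec surjective?
    where
    injective? : Dec (Injective _≡_ _≡_ σ)
    injective? = map′ (λ h {x} {y} → h x y) (λ h x y → h {x} {y})
      (Finₚ.all? λ x → Finₚ.all? λ y → (σ x Finₚ.≟ σ y) →-dec (x Finₚ.≟ y))
    surjective? : Dec (Surjective _≡_ _≡_ σ)
    surjective? = map′
      (λ h y → proj₁ (h y) , λ { refl → proj₂ (h y) })
      (λ h y → proj₁ (h y) , proj₂ (h y) refl)
      (Finₚ.all? λ y → Finₚ.any? λ x → σ x Finₚ.≟ y)

  -- deduplicate keeps exactly one representative of each cycle.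
  cycles : ℕ
  cycles = length (deduplicate sameCycle? (allFin n))

-- finToFun is a bijection (up to pointwise equality) from Fin (n ^ n) to
-- the functions Fin n → Fin n, so each permutation is listed exactly once.
perms : ∀ n → List (Fin n → Fin n)
perms n = filter bijective? (map finToFun (allFin (n ℕ.^ n)))

C[_,_] : ℕ → ℕ → ℕ
C[ n , k ] = length (filter (λ σ → cycles σ ℕₚ.≟ k) (perms n))

fromℕ : ℕ → ℚ
fromℕ n = + n / 1

∑< : ℕ → (ℕ → ℚ) → ℚ
∑< zero    f = 0ℚ
∑< (suc n) f = ∑< n f + f n

-- The library's k P s is the falling factorial k (k ∸ 1) ⋯ (k ∸ s + 1).
-- A permutation of n points has at most n cycles, so the sum stops at n.
β : ℕ → ℕ → ℚ
β s n = ∑< (suc n) λ k → fromℕ (k P s) * ((+ C[ n , k ] / n !) {{n ℕₚ.!≢0}})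

private
  sub-add : ∀ a b c → (a - b) + (b - c) ≡ a - c
  sub-add = solve 3 (λ a b c → (a :- b) :+ (b :- c) := a :- c) refl
    where open +-*-Solver

  neg-sub : ∀ a b → - (a - b) ≡ b - a
  neg-sub = solve 2 (λ a b → :- (a :- b) := b :- a) refl
    where open +-*-Solver

  add-sub : ∀ a b → a + (b - a) ≡ b
  add-sub = solve 2 (λ a b → a :+ (b :- a) := b) refl
    where open +-*-Solver

∣p-q∣≤ : ∀ p q {r} → p - q ≤ r → q - p ≤ r → ∣ p - q ∣ ≤ r
∣p-q∣≤ p q {r} h₁ h₂ with ∣p∣≡p∨∣p∣≡-p (p - q)
... | inj₁ eq = subst (_≤ r) (sym eq) h₁
... | inj₂ eq = subst (_≤ r) (sym (trans eq (neg-sub p q))) h₂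

p≤∣p∣ : ∀ p → p ≤ ∣ p ∣
p≤∣p∣ p with ≤-total 0ℚ p
... | inj₁ 0≤p = ≤-reflexive (sym (0≤p⇒∣p∣≡p 0≤p))
... | inj₂ p≤0 = ≤-trans p≤0 (0≤∣p∣ p)

∣p-q∣≡∣q-p∣ : ∀ p q → ∣ p - q ∣ ≡ ∣ q - p ∣
∣p-q∣≡∣q-p∣ p q = trans (sym (∣-p∣≡∣p∣ (p - q))) (cong ∣_∣ (neg-sub p q))

∣p-r∣≤∣p-q∣+∣q-r∣ : ∀ p q r → ∣ p - r ∣ ≤ ∣ p - q ∣ + ∣ q - r ∣
∣p-r∣≤∣p-q∣+∣q-r∣ p q r =
  subst (λ x → ∣ x ∣ ≤ ∣ p - q ∣ + ∣ q - r ∣) (sub-add p q r)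
        (∣p+q∣≤∣p∣+∣q∣ (p - q) (q - r))

p≤q+r⇒p-q≤r : ∀ p q {r} → p ≤ q + r → p - q ≤ r
p≤q+r⇒p-q≤r p q {r} h = subst (p - q ≤_) (lem q r) (+-monoˡ-≤ (- q) h)
  where
  open +-*-Solver
  lem : ∀ q r → (q + r) - q ≡ r
  lem = solve 2 (λ q r → (q :+ r) :- q := r) refl

0<½p : ∀ {p} → 0ℚ < p → 0ℚ < ½ * p
0<½p {p} 0<p = positive⁻¹ (½ * p) {{pos*pos⇒pos ½ p {{positive 0<p}}}}

½p+½p≡p : ∀ p → ½ * p + ½ * p ≡ p
½p+½p≡p = solve 1 (λ p → con ½ :* p :+ con ½ :* p := p) refl
  where open +-*-Solver

0<p+q : ∀ {p q} → 0ℚ < p → 0ℚ ≤ q → 0ℚ < p + q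
0<p+q 0<p 0≤q = +-mono-<-≤ 0<p 0≤q

0<p*q : ∀ {p q} → 0ℚ < p → 0ℚ < q → 0ℚ < p * q
0<p*q {p} {q} 0<p 0<q =
  positive⁻¹ (p * q) {{pos*pos⇒pos p {{positive 0<p}} q {{positive 0<q}}}}

*-mono-≤ : ∀ {p q r s} → 0ℚ ≤ q → 0ℚ ≤ r → p ≤ q → r ≤ s → p * r ≤ q * s
*-mono-≤ {p} {q} {r} {s} 0≤q 0≤r p≤q r≤s = ≤-trans
  (*-monoʳ-≤-nonNeg r {{nonNegative 0≤r}} p≤q)
  (*-monoˡ-≤-nonNeg q {{nonNegative 0≤q}} r≤s)

-- Total reciprocal, with the value 0 at 0; it is only ever evaluated at
-- arguments bounded away from 0.
recip : ℚ → ℚ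
recip p with p ≟ 0ℚ
... | yes _  = 0ℚ
... | no p≢0 = (1/ p) {{≢-nonZero p≢0}}

*-recip : ∀ {p} → 0ℚ < p → p * recip p ≡ 1ℚ
*-recip {p} 0<p with p ≟ 0ℚ
... | yes p≡0 = contradiction (sym p≡0) (<⇒≢ 0<p)
... | no  p≢0 = *-inverseʳ p {{≢-nonZero p≢0}}

0<recip : ∀ {p} → 0ℚ < p → 0ℚ < recip p
0<recip {p} 0<p with p ≟ 0ℚ
... | yes p≡0 = contradiction (sym p≡0) (<⇒≢ 0<p)
... | no  p≢0 = positive⁻¹ _ {{1/pos⇒pos p {{positive 0<p}}}}

recip-unique : ∀ {p q} → 0ℚ < p → p * q ≡ 1ℚ → recip p ≡ q
recip-unique {p} {q} 0<p pq≡1 =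
  trans (sym (*-identityʳ (recip p)))
  (trans (cong (recip p *_) (sym pq≡1))
  (trans (lem p q (recip p))
  (trans (cong (_* q) (*-recip 0<p)) (*-identityˡ q))))
  where
  open +-*-Solver
  lem : ∀ p q r → r * (p * q) ≡ p * r * q
  lem = solve 3 (λ p q r → r :* (p :* q) := p :* r :* q) refl

IsCauchy : (ℕ → ℚ) → Set
IsCauchy x = ∀ ε → 0ℚ < ε →
  ∃ λ N → ∀ m n → N ℕ.≤ m → N ℕ.≤ n → ∣ x m - x n ∣ ≤ ε

record ℝ : Set where
  constructor mkℝ
  field
    seq    : ℕ → ℚ
    cauchy : IsCauchy seq

open ℝ public

infix  4 _≤ℝ_ _<ℝ_
infixl 6 _+ℝ_ _-ℝ_
infixl 7 _*ℝ_
infix  8 -ℝ_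

_≤ℝ_ : ℝ → ℝ → Set
x ≤ℝ y = ∀ ε → 0ℚ < ε → ∃ λ N → ∀ n → N ℕ.≤ n → seq x n ≤ seq y n + ε

_<ℝ_ : ℝ → ℝ → Set
x <ℝ y = ∃ λ ε → 0ℚ < ε × ∃ λ N → ∀ n → N ℕ.≤ n → seq x n + ε ≤ seq y n

fromℚ : ℚ → ℝ
fromℚ p = mkℝ (λ _ → p) λ ε 0<ε → 0 , λ _ _ _ _ →
  subst (λ q → ∣ q ∣ ≤ ε) (sym (+-inverseʳ p)) (<⇒≤ 0<ε)

0ℝ 1ℝ : ℝ
0ℝ = fromℚ 0ℚ
1ℝ = fromℚ 1ℚ

bounded : ∀ {x} → IsCauchy x →
          ∃ λ B → 0ℚ < B × ∃ λ N → ∀ n → N ℕ.≤ n → ∣ x n ∣ ≤ B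
bounded {x} cx = let N , h = cx 1ℚ (positive⁻¹ 1ℚ) in
  1ℚ + ∣ x N ∣ , 0<p+q (positive⁻¹ 1ℚ) (0≤∣p∣ (x N)) , N , λ n N≤n →
    subst (λ y → ∣ y ∣ ≤ 1ℚ + ∣ x N ∣) (lem (x n) (x N))
      (≤-trans (∣p+q∣≤∣p∣+∣q∣ (x n - x N) (x N))
               (+-monoˡ-≤ ∣ x N ∣ (h n N N≤n ℕₚ.≤-refl)))
  where
  open +-*-Solver
  lem : ∀ a b → (a - b) + b ≡ a
  lem = solve 2 (λ a b → (a :- b) :+ b := a) refl

_+ℝ_ : ℝ → ℝ → ℝ
x +ℝ y = mkℝ (λ n → seq x n + seq y n) proof
  where
  lem : ∀ a b c d → (a - c) + (b - d) ≡ (a + b) - (c + d)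
  lem = solve 4 (λ a b c d → (a :- c) :+ (b :- d) := (a :+ b) :- (c :+ d)) refl
    where open +-*-Solver
  proof : IsCauchy (λ n → seq x n + seq y n)
  proof ε 0<ε =
    let N₁ , h₁ = cauchy x (½ * ε) (0<½p 0<ε)
        N₂ , h₂ = cauchy y (½ * ε) (0<½p 0<ε)
    in N₁ ℕ.⊔ N₂ , λ m n N≤m N≤n →
      subst₂ (λ p q → ∣ p ∣ ≤ q)
        (lem (seq x m) (seq y m) (seq x n) (seq y n)) (½p+½p≡p ε)
        (≤-trans (∣p+q∣≤∣p∣+∣q∣ (seq x m - seq x n) (seq y m - seq y n))
          (+-mono-≤
            (h₁ m n (ℕₚ.m⊔n≤o⇒m≤o N₁ N₂ N≤m) (ℕₚ.m⊔n≤o⇒m≤o N₁ N₂ N≤n))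
            (h₂ m n (ℕₚ.m⊔n≤o⇒n≤o N₁ N₂ N≤m) (ℕₚ.m⊔n≤o⇒n≤o N₁ N₂ N≤n))))

-ℝ_ : ℝ → ℝ
-ℝ x = mkℝ (λ n → - seq x n) λ ε 0<ε →
  proj₁ (cauchy x ε 0<ε) , λ m n N≤m N≤n →
    subst (_≤ ε)
      (trans (sym (∣-p∣≡∣p∣ (seq x m - seq x n)))
             (cong ∣_∣ (neg-distrib-+ (seq x m) (- seq x n))))
      (proj₂ (cauchy x ε 0<ε) m n N≤m N≤n)

_-ℝ_ : ℝ → ℝ → ℝ
x -ℝ y = x +ℝ (-ℝ y)

*-close : ∀ {a b c d A D ε} → 0ℚ < A → 0ℚ < D → ∣ a ∣ ≤ A → ∣ d ∣ ≤ D →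
          ∣ a - c ∣ ≤ ½ * ε * recip D → ∣ b - d ∣ ≤ ½ * ε * recip A →
          ∣ a * b - c * d ∣ ≤ ε
*-close {a} {b} {c} {d} {A} {D} {ε} 0<A 0<D ∣a∣≤A ∣d∣≤D ac bd = begin
  ∣ a * b - c * d ∣
    ≡⟨ cong ∣_∣ (sym (lem a b c d)) ⟩
  ∣ a * (b - d) + d * (a - c) ∣
    ≤⟨ ∣p+q∣≤∣p∣+∣q∣ (a * (b - d)) (d * (a - c)) ⟩
  ∣ a * (b - d) ∣ + ∣ d * (a - c) ∣
    ≤⟨ +-mono-≤ (bound a (b - d) A 0<A ∣a∣≤A bd) (bound d (a - c) D 0<D ∣d∣≤D ac) ⟩
  ½ * ε + ½ * ε
    ≡⟨ ½p+½p≡p ε ⟩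
  ε ∎
  where
  open ≤-Reasoning
  open +-*-Solver
  lem : ∀ a b c d → a * (b - d) + d * (a - c) ≡ a * b - c * d
  lem = solve 4 (λ a b c d → a :* (b :- d) :+ d :* (a :- c) := a :* b :- c :* d) refl
  scale : ∀ B r η → B * (η * r) ≡ (B * r) * η
  scale = solve 3 (λ B r η → B :* (η :* r) := (B :* r) :* η) refl
  bound : ∀ p q B → 0ℚ < B → ∣ p ∣ ≤ B → ∣ q ∣ ≤ ½ * ε * recip B → ∣ p * q ∣ ≤ ½ * ε
  bound p q B 0<B p≤ q≤ = subst₂ _≤_ (sym (∣p*q∣≡∣p∣*∣q∣ p q))
    (trans (scale B (recip B) (½ * ε))
    (trans (cong (_* (½ * ε)) (*-recip 0<B)) (*-identityˡ (½ * ε))))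
    (*-mono-≤ (<⇒≤ 0<B) (0≤∣p∣ q) p≤ q≤)

_*ℝ_ : ℝ → ℝ → ℝ
x *ℝ y = mkℝ (λ n → seq x n * seq y n) proof
  where
  proof : IsCauchy (λ n → seq x n * seq y n)
  proof ε 0<ε =
    let A , 0<A , K₁ , b₁ = bounded (cauchy x)
        D , 0<D , K₂ , b₂ = bounded (cauchy y)
        N₁ , h₁ = cauchy x (½ * ε * recip D) (0<p*q (0<½p 0<ε) (0<recip 0<D))
        N₂ , h₂ = cauchy y (½ * ε * recip A) (0<p*q (0<½p 0<ε) (0<recip 0<A))
    in (K₁ ℕ.⊔ K₂) ℕ.⊔ (N₁ ℕ.⊔ N₂) , λ m n N≤m N≤n →
      let K≤m = ℕₚ.m⊔n≤o⇒m≤o (K₁ ℕ.⊔ K₂) (N₁ ℕ.⊔ N₂) N≤m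
          K≤n = ℕₚ.m⊔n≤o⇒m≤o (K₁ ℕ.⊔ K₂) (N₁ ℕ.⊔ N₂) N≤n
          L≤m = ℕₚ.m⊔n≤o⇒n≤o (K₁ ℕ.⊔ K₂) (N₁ ℕ.⊔ N₂) N≤m
          L≤n = ℕₚ.m⊔n≤o⇒n≤o (K₁ ℕ.⊔ K₂) (N₁ ℕ.⊔ N₂) N≤n
      in *-close {seq x m} {seq y m} {seq x n} {seq y n} 0<A 0<D
           (b₁ m (ℕₚ.m⊔n≤o⇒m≤o K₁ K₂ K≤m))
           (b₂ n (ℕₚ.m⊔n≤o⇒n≤o K₁ K₂ K≤n))
           (h₁ m n (ℕₚ.m⊔n≤o⇒m≤o N₁ N₂ L≤m) (ℕₚ.m⊔n≤o⇒m≤o N₁ N₂ L≤n))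
           (h₂ m n (ℕₚ.m⊔n≤o⇒n≤o N₁ N₂ L≤m) (ℕₚ.m⊔n≤o⇒n≤o N₁ N₂ L≤n))

∣_∣ℝ : ℝ → ℝ
∣ x ∣ℝ = mkℝ (λ n → ∣ seq x n ∣) λ ε 0<ε →
  proj₁ (cauchy x ε 0<ε) , λ m n N≤m N≤n →
    ≤-trans (reverse-triangle (seq x m) (seq x n))
            (proj₂ (cauchy x ε 0<ε) m n N≤m N≤n)
  where
  half : ∀ p q → ∣ p ∣ - ∣ q ∣ ≤ ∣ p - q ∣
  half p q = p≤q+r⇒p-q≤r ∣ p ∣ ∣ q ∣
    (subst (λ r → ∣ r ∣ ≤ ∣ q ∣ + ∣ p - q ∣) (add-sub q p)
           (∣p+q∣≤∣p∣+∣q∣ q (p - q)))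
  reverse-triangle : ∀ p q → ∣ ∣ p ∣ - ∣ q ∣ ∣ ≤ ∣ p - q ∣
  reverse-triangle p q = ∣p-q∣≤ ∣ p ∣ ∣ q ∣ (half p q)
    (subst (∣ q ∣ - ∣ p ∣ ≤_) (∣p-q∣≡∣q-p∣ q p) (half q p))

recip-close : ∀ {δ p q ε} → 0ℚ < δ → δ ≤ p → δ ≤ q →
              ∣ p - q ∣ ≤ δ * δ * ε → ∣ recip p - recip q ∣ ≤ ε
recip-close {δ} {p} {q} {ε} 0<δ δ≤p δ≤q h = begin
  ∣ recip p - recip q ∣
    ≡⟨ cong ∣_∣ (sym difference) ⟩
  ∣ recip p * recip q * (q - p) ∣
    ≡⟨ ∣p*q∣≡∣p∣*∣q∣ (recip p * recip q) (q - p) ⟩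
  ∣ recip p * recip q ∣ * ∣ q - p ∣
    ≡⟨ cong₂ _*_ (0≤p⇒∣p∣≡p (<⇒≤ (0<p*q (0<recip 0<p) (0<recip 0<q)))) (∣p-q∣≡∣q-p∣ q p) ⟩
  recip p * recip q * ∣ p - q ∣
    ≤⟨ *-mono-≤ (<⇒≤ (0<p*q 0<r 0<r)) (0≤∣p∣ _)
         (*-mono-≤ (<⇒≤ 0<r) (<⇒≤ (0<recip 0<q)) (recip-≤ 0<p δ≤p) (recip-≤ 0<q δ≤q)) h ⟩
  recip δ * recip δ * (δ * δ * ε)
    ≡⟨ rearrange (recip δ) δ ε ⟩
  (δ * recip δ) * ((δ * recip δ) * ε)
    ≡⟨ cong (λ t → t * (t * ε)) (*-recip 0<δ) ⟩
  1ℚ * (1ℚ * ε)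
    ≡⟨ trans (*-identityˡ (1ℚ * ε)) (*-identityˡ ε) ⟩
  ε ∎
  where
  open ≤-Reasoning
  open +-*-Solver
  0<p : 0ℚ < p
  0<p = <-≤-trans 0<δ δ≤p
  0<q : 0ℚ < q
  0<q = <-≤-trans 0<δ δ≤q
  0<r : 0ℚ < recip δ
  0<r = 0<recip 0<δ
  recip-≤ : ∀ {p} → 0ℚ < p → δ ≤ p → recip p ≤ recip δ
  recip-≤ {p} 0<p δ≤p =
    subst₂ _≤_ (trans (cong (_* recip p) (trans (*-comm (recip δ) δ) (*-recip 0<δ)))
                      (*-identityˡ _))
               (trans (*-assoc (recip δ) p (recip p))
                      (trans (cong (recip δ *_) (*-recip 0<p)) (*-identityʳ _)))
      (*-monoʳ-≤-nonNeg (recip p) {{nonNegative (<⇒≤ (0<recip 0<p))}}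
        (*-monoˡ-≤-nonNeg (recip δ) {{nonNegative (<⇒≤ 0<r)}} δ≤p))
  lem : ∀ a b c d → c * d * (b - a) ≡ (b * d) * c - (a * c) * d
  lem = solve 4 (λ a b c d → c :* d :* (b :- a) := (b :* d) :* c :- (a :* c) :* d) refl
  difference : recip p * recip q * (q - p) ≡ recip p - recip q
  difference = trans (lem p q (recip p) (recip q))
    (cong₂ _-_ (trans (cong (_* recip p) (*-recip 0<q)) (*-identityˡ (recip p)))
               (trans (cong (_* recip q) (*-recip 0<p)) (*-identityˡ (recip q))))
  rearrange : ∀ r d e → r * r * (d * d * e) ≡ (d * r) * ((d * r) * e)
  rearrange = solve 3 (λ r d e → r :* r :* (d :* d :* e) := (d :* r) :* ((d :* r) :* e)) refl

reciprocal : (x : ℝ) → 0ℝ <ℝ x → ℝ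
reciprocal x (δ , 0<δ , K , δ≤x) = mkℝ (λ n → recip (seq x n)) proof
  where
  δ≤ : ∀ n → K ℕ.≤ n → δ ≤ seq x n
  δ≤ n K≤n = subst (_≤ seq x n) (+-identityˡ δ) (δ≤x n K≤n)
  proof : IsCauchy (λ n → recip (seq x n))
  proof ε 0<ε =
    let N , h = cauchy x (δ * δ * ε) (0<p*q (0<p*q 0<δ 0<δ) 0<ε)
    in K ℕ.⊔ N , λ m n N≤m N≤n →
      recip-close 0<δ (δ≤ m (ℕₚ.m⊔n≤o⇒m≤o K N N≤m)) (δ≤ n (ℕₚ.m⊔n≤o⇒m≤o K N N≤n))
        (h m n (ℕₚ.m⊔n≤o⇒n≤o K N N≤m) (ℕₚ.m⊔n≤o⇒n≤o K N N≤n))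

_^ℝ_ : ℝ → ℕ → ℝ
x ^ℝ zero  = 1ℝ
x ^ℝ suc n = x *ℝ (x ^ℝ n)

zpow : (x : ℝ) → 0ℝ <ℝ x → ℤ → ℝ
zpow x _   (+ n)    = x ^ℝ n
zpow x 0<x -[1+ n ] = reciprocal x 0<x ^ℝ suc n

u : ℕ → ℚ
u k = + 1 / suc k

H : ℕ → ℚ
H n = ∑< n u

fromℚᵘ-homo-+ : ∀ p q → fromℚᵘ (p ℚᵘ.+ q) ≡ fromℚᵘ p + fromℚᵘ q
fromℚᵘ-homo-+ p q = toℚᵘ-injective
  (ℚᵘₚ.≃-trans (toℚᵘ-fromℚᵘ (p ℚᵘ.+ q))
  (ℚᵘₚ.≃-trans (ℚᵘₚ.+-cong (ℚᵘₚ.≃-sym (toℚᵘ-fromℚᵘ p)) (ℚᵘₚ.≃-sym (toℚᵘ-fromℚᵘ q)))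
               (ℚᵘₚ.≃-sym (toℚᵘ-homo-+ (fromℚᵘ p) (fromℚᵘ q)))))

fromℚᵘ-homo-* : ∀ p q → fromℚᵘ (p ℚᵘ.* q) ≡ fromℚᵘ p * fromℚᵘ q
fromℚᵘ-homo-* p q = toℚᵘ-injective
  (ℚᵘₚ.≃-trans (toℚᵘ-fromℚᵘ (p ℚᵘ.* q))
  (ℚᵘₚ.≃-trans (ℚᵘₚ.*-cong (ℚᵘₚ.≃-sym (toℚᵘ-fromℚᵘ p)) (ℚᵘₚ.≃-sym (toℚᵘ-fromℚᵘ q)))
               (ℚᵘₚ.≃-sym (toℚᵘ-homo-* (fromℚᵘ p) (fromℚᵘ q)))))

fromℕ-+ : ∀ a b → fromℕ (a ℕ.+ b) ≡ fromℕ a + fromℕ b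
fromℕ-+ a b = trans
  (fromℚᵘ-cong {mkℚᵘ (+ (a ℕ.+ b)) 0} {mkℚᵘ (+ a) 0 ℚᵘ.+ mkℚᵘ (+ b) 0}
    (ℚᵘ.*≡* (cong (ℤ._* + 1)
      (sym (cong₂ ℤ._+_ (ℤₚ.*-identityʳ (+ a)) (ℤₚ.*-identityʳ (+ b)))))))
  (fromℚᵘ-homo-+ (mkℚᵘ (+ a) 0) (mkℚᵘ (+ b) 0))

fromℕ-* : ∀ a b → fromℕ (a ℕ.* b) ≡ fromℕ a * fromℕ b
fromℕ-* a b = trans
  (fromℚᵘ-cong {mkℚᵘ (+ (a ℕ.* b)) 0} {mkℚᵘ (+ a) 0 ℚᵘ.* mkℚᵘ (+ b) 0}
    (ℚᵘ.*≡* (cong (ℤ._* + 1) (ℤₚ.pos-* a b))))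
  (fromℚᵘ-homo-* (mkℚᵘ (+ a) 0) (mkℚᵘ (+ b) 0))

/≡*u : ∀ a k → + a / suc k ≡ fromℕ a * u k
/≡*u a k = trans
  (fromℚᵘ-cong {mkℚᵘ (+ a) k} {mkℚᵘ (+ a) 0 ℚᵘ.* mkℚᵘ (+ 1) k}
    (ℚᵘ.*≡* (cong₂ ℤ._*_ (sym (ℤₚ.*-identityʳ (+ a))) (cong +_ (ℕₚ.*-identityˡ (suc k))))))
  (fromℚᵘ-homo-* (mkℚᵘ (+ a) 0) (mkℚᵘ (+ 1) k))

fromℕ*u≡1 : ∀ k → fromℕ (suc k) * u k ≡ 1ℚ
fromℕ*u≡1 k = trans (sym (/≡*u (suc k) k))
  (fromℚᵘ-cong {mkℚᵘ (+ suc k) k} {mkℚᵘ (+ 1) 0}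
    (ℚᵘ.*≡* (ℤₚ.*-comm (+ suc k) (+ 1))))

0≤fromℕ : ∀ n → 0ℚ ≤ fromℕ n
0≤fromℕ n = nonNegative⁻¹ _ {{normalize-nonNeg n 1}}

0<fromℕ-suc : ∀ n → 0ℚ < fromℕ (suc n)
0<fromℕ-suc n = positive⁻¹ _ {{normalize-pos (suc n) 1}}

0<u : ∀ k → 0ℚ < u k
0<u k = positive⁻¹ _ {{normalize-pos 1 (suc k)}}

p≤p+q : ∀ {p q} → 0ℚ ≤ q → p ≤ p + q
p≤p+q {p} {q} 0≤q = subst (_≤ p + q) (+-identityʳ p) (+-monoʳ-≤ p 0≤q)

fromℕ-mono-≤ : ∀ {a b} → a ℕ.≤ b → fromℕ a ≤ fromℕ b
fromℕ-mono-≤ {a} {b} a≤b =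
  subst (fromℕ a ≤_) (trans (sym (fromℕ-+ a (b ℕ.∸ a))) (cong fromℕ (ℕₚ.m+[n∸m]≡n a≤b)))
        (p≤p+q (0≤fromℕ (b ℕ.∸ a)))

u-anti-≤ : ∀ {a b} → a ℕ.≤ b → u b ≤ u a
u-anti-≤ {a} {b} a≤b = subst₂ _≤_
  (trans (lem (u b) (fromℕ (suc a)) (u a))
         (trans (cong (u b *_) (fromℕ*u≡1 a)) (*-identityʳ (u b))))
  (trans (cong (_* u a) (trans (*-comm (u b) _) (fromℕ*u≡1 b))) (*-identityˡ (u a)))
  (*-monoʳ-≤-nonNeg (u a) {{nonNegative (<⇒≤ (0<u a))}}
    (*-monoˡ-≤-nonNeg (u b) {{nonNegative (<⇒≤ (0<u b))}} (fromℕ-mono-≤ (s≤s a≤b))))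
  where
  open +-*-Solver
  lem : ∀ x y z → x * y * z ≡ x * (y * z)
  lem = solve 3 (λ x y z → x :* y :* z := x :* (y :* z)) refl

archimedean : ∀ ε → 0ℚ < ε → ∃ λ N → ∀ n → N ℕ.≤ n → u n ≤ ε
archimedean ε 0<ε with ε | positive 0<ε
... | mkℚ (+ suc a) d c | _ = d , λ n d≤n → ≤-trans (u-anti-≤ d≤n)
  (toℚᵘ-cancel-≤ (ℚᵘₚ.≤-trans (ℚᵘₚ.≤-reflexive (toℚᵘ-fromℚᵘ (mkℚᵘ (+ 1) d)))
    (ℚᵘ.*≤* (ℤₚ.*-monoʳ-≤-nonNeg (+ suc d) {+ 1} {+ suc a} (ℤ.+≤+ (s≤s z≤n))))))

u-scale : ∀ t k → fromℕ (suc k) * u (k ℕ.+ t ℕ.* suc k) ≡ u t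
u-scale t k = trans (sym (*-identityˡ _))
  (trans (cong (_* (fromℕ (suc k) * v)) (sym (fromℕ*u≡1 t)))
  (trans (lem (fromℕ (suc t)) (u t) (fromℕ (suc k)) v)
  (trans (cong (λ x → u t * (x * v)) (sym (fromℕ-* (suc t) (suc k))))
  (trans (cong (u t *_) (fromℕ*u≡1 (k ℕ.+ t ℕ.* suc k))) (*-identityʳ (u t))))))
  where
  v : ℚ
  v = u (k ℕ.+ t ℕ.* suc k)
  open +-*-Solver
  lem : ∀ a b c d → a * b * (c * d) ≡ b * ((a * c) * d)
  lem = solve 4 (λ a b c d → a :* b :* (c :* d) := b :* ((a :* c) :* d)) refl

∑<-cong : ∀ n {f g : ℕ → ℚ} → (∀ i → f i ≡ g i) → ∑< n f ≡ ∑< n g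
∑<-cong zero    h = refl
∑<-cong (suc n) h = cong₂ _+_ (∑<-cong n h) (h n)

∑<-mono : ∀ n {f g : ℕ → ℚ} → (∀ i → i ℕ.< n → f i ≤ g i) → ∑< n f ≤ ∑< n g
∑<-mono zero    h = ≤-refl
∑<-mono (suc n) h =
  +-mono-≤ (∑<-mono n λ i i<n → h i (ℕₚ.m<n⇒m<1+n i<n)) (h n (ℕₚ.n<1+n n))

∑<-const : ∀ n c → ∑< n (λ _ → c) ≡ fromℕ n * c
∑<-const zero    c = sym (*-zeroˡ c)
∑<-const (suc n) c = trans (cong (_+ c) (∑<-const n c))
  (trans (lem (fromℕ n) c)
         (cong (_* c) (trans (sym (fromℕ-+ n 1)) (cong fromℕ (ℕₚ.+-comm n 1)))))
  where
  open +-*-Solver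
  lem : ∀ n c → n * c + c ≡ (n + 1ℚ) * c
  lem = solve 2 (λ n c → n :* c :+ c := (n :+ con 1ℚ) :* c) refl

∑<-split : ∀ a b (f : ℕ → ℚ) → ∑< (a ℕ.+ b) f ≡ ∑< a f + ∑< b (λ i → f (a ℕ.+ i))
∑<-split a zero    f =
  trans (cong (λ n → ∑< n f) (ℕₚ.+-identityʳ a)) (sym (+-identityʳ (∑< a f)))
∑<-split a (suc b) f = trans (cong (λ n → ∑< n f) (ℕₚ.+-suc a b))
  (trans (cong (_+ f (a ℕ.+ b)) (∑<-split a b f)) (+-assoc (∑< a f) _ _))

∑<-blocks : ∀ n q (f : ℕ → ℚ) →
            ∑< (n ℕ.* q) f ≡ ∑< n (λ i → ∑< q (λ j → f (i ℕ.* q ℕ.+ j)))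
∑<-blocks zero    q f = refl
∑<-blocks (suc n) q f = trans (cong (λ k → ∑< k f) (ℕₚ.+-comm q (n ℕ.* q)))
  (trans (∑<-split (n ℕ.* q) q f)
         (cong (_+ ∑< q (λ j → f (n ℕ.* q ℕ.+ j))) (∑<-blocks n q f)))

block : ℕ → ℕ → ℚ
block q t = ∑< q λ j → u (t ℕ.* q ℕ.+ j)

u≤block : ∀ k t → u t ≤ block (suc k) t
u≤block k t = subst (_≤ block (suc k) t) (trans (∑<-const (suc k) _) (u-scale t k))
  (∑<-mono (suc k) λ j j<q → u-anti-≤
    (subst (t ℕ.* suc k ℕ.+ j ℕ.≤_) (ℕₚ.+-comm (t ℕ.* suc k) k)
           (ℕₚ.+-monoʳ-≤ (t ℕ.* suc k) (ℕ.s≤s⁻¹ j<q))))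

block≤u : ∀ k t → block (suc k) (suc t) ≤ u t
block≤u k t = subst (block (suc k) (suc t) ≤_) (trans (∑<-const (suc k) _) (u-scale t k))
  (∑<-mono (suc k) λ j _ → u-anti-≤
    (ℕₚ.≤-trans (ℕₚ.n≤1+n (k ℕ.+ t ℕ.* suc k)) (ℕₚ.m≤m+n (suc (k ℕ.+ t ℕ.* suc k)) j)))

-- Right Riemann sum of f over [a , a + ℓ], with mesh 1 / (m + 1).
riemann : (ℚ → ℚ) → ℚ → ℕ → ℕ → ℚ
riemann f a ℓ m = ∑< (ℓ ℕ.* suc m) λ i → f (a + (+ suc i / suc m)) * (+ 1 / suc m)

-- The same sum for f x = 1/x on [1 , 1 + ℓ] with mesh 1 / p, each term
-- (1 / p) / (1 + (i + 1) / p) simplified to 1 / (p + i + 1).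
S : ℕ → ℕ → ℚ
S ℓ p = ∑< (ℓ ℕ.* p) λ i → u (p ℕ.+ i)

riemann≡S : ∀ ℓ m → riemann recip 1ℚ ℓ m ≡ S ℓ (suc m)
riemann≡S ℓ m = ∑<-cong (ℓ ℕ.* suc m) term
  where
  lem₁ : ∀ M I v w → M * v ≡ 1ℚ → (1ℚ + I * v) * (M * w) ≡ (M + I) * w
  lem₁ M I v w eq = trans
    (solve 4 (λ M I v w → (con 1ℚ :+ I :* v) :* (M :* w) := M :* w :+ (M :* v) :* (I :* w)) refl M I v w)
    (trans (cong (λ t → M * w + t * (I * w)) eq)
    (solve 3 (λ M I w → M :* w :+ con 1ℚ :* (I :* w) := (M :+ I) :* w) refl M I w))
    where open +-*-Solver
  lem₂ : ∀ M v w → M * w * v ≡ (M * v) * w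
  lem₂ = solve 3 (λ M v w → M :* w :* v := (M :* v) :* w) refl
    where open +-*-Solver
  term : ∀ i → recip (1ℚ + (+ suc i / suc m)) * (+ 1 / suc m) ≡ u (suc m ℕ.+ i)
  term i = trans (cong (_* u m) (recip-unique 0<x x*y≡1))
    (trans (lem₂ (fromℕ (suc m)) (u m) w)
    (trans (cong (_* w) (fromℕ*u≡1 m)) (*-identityˡ w)))
    where
    w : ℚ
    w = u (suc m ℕ.+ i)
    0<x : 0ℚ < 1ℚ + (+ suc i / suc m)
    0<x = 0<p+q {1ℚ} {+ suc i / suc m} (positive⁻¹ 1ℚ)
      (nonNegative⁻¹ (+ suc i / suc m) {{normalize-nonNeg (suc i) (suc m)}})
    x*y≡1 : (1ℚ + (+ suc i / suc m)) * (fromℕ (suc m) * w) ≡ 1ℚ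
    x*y≡1 = trans (cong (λ t → (1ℚ + t) * (fromℕ (suc m) * w)) (/≡*u (suc i) m))
      (trans (lem₁ (fromℕ (suc m)) (fromℕ (suc i)) (u m) w (fromℕ*u≡1 m))
      (trans (cong (_* w) (trans (sym (fromℕ-+ (suc m) (suc i)))
                                 (cong fromℕ (ℕₚ.+-suc (suc m) i))))
             (fromℕ*u≡1 (suc m ℕ.+ i))))

S-blocks : ∀ ℓ p q → S ℓ (p ℕ.* q) ≡ ∑< (ℓ ℕ.* p) (λ i → block q (p ℕ.+ i))
S-blocks ℓ p q = trans (cong (λ n → ∑< n (λ i → u (p ℕ.* q ℕ.+ i))) (sym (ℕₚ.*-assoc ℓ p q)))
  (trans (∑<-blocks (ℓ ℕ.* p) q _)
  (∑<-cong (ℓ ℕ.* p) λ i → ∑<-cong q λ j → cong u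
    (trans (sym (ℕₚ.+-assoc (p ℕ.* q) (i ℕ.* q) j))
           (cong (ℕ._+ j) (sym (ℕₚ.*-distribʳ-+ q p i))))))

S-refine-≥ : ∀ ℓ p k → S ℓ p ≤ S ℓ (p ℕ.* suc k)
S-refine-≥ ℓ p k = subst (S ℓ p ≤_) (sym (S-blocks ℓ p (suc k)))
  (∑<-mono (ℓ ℕ.* p) λ i _ → u≤block k (p ℕ.+ i))

S-refine-≤ : ∀ ℓ m k → S ℓ (suc m ℕ.* suc k) ≤ S ℓ (suc m) + u m
S-refine-≤ ℓ m k = ≤-trans
  (≤-reflexive (S-blocks ℓ (suc m) (suc k)))
  (≤-trans (∑<-mono (ℓ ℕ.* suc m) λ i _ → block≤u k (m ℕ.+ i))
  (≤-trans (p≤p+q (<⇒≤ (0<u (m ℕ.+ ℓ ℕ.* suc m))))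
           (≤-reflexive (telescope (ℓ ℕ.* suc m)))))
  where
  open +-*-Solver
  lem : ∀ a b c → a + b + c ≡ a + c + b
  lem = solve 3 (λ a b c → a :+ b :+ c := a :+ c :+ b) refl
  telescope : ∀ n → ∑< n (λ i → u (m ℕ.+ i)) + u (m ℕ.+ n)
                  ≡ ∑< n (λ i → u (suc m ℕ.+ i)) + u m
  telescope zero    = cong (λ k → 0ℚ + u k) (ℕₚ.+-identityʳ m)
  telescope (suc n) = trans (cong (_+ u (m ℕ.+ suc n)) (telescope n))
    (trans (lem (∑< n (λ i → u (suc m ℕ.+ i))) (u m) (u (m ℕ.+ suc n)))
           (cong (λ k → ∑< n (λ i → u (suc m ℕ.+ i)) + u k + u m) (ℕₚ.+-suc m n)))

S-close : ∀ ℓ m k → S ℓ (suc m) - S ℓ (suc k) ≤ u k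
S-close ℓ m k = p≤q+r⇒p-q≤r (S ℓ (suc m)) (S ℓ (suc k)) (≤-trans (S-refine-≥ ℓ (suc m) k)
  (subst (λ p → S ℓ p ≤ S ℓ (suc k) + u k) (ℕₚ.*-comm (suc k) (suc m)) (S-refine-≤ ℓ k m)))

riemann-cauchy : ∀ ℓ → IsCauchy (riemann recip 1ℚ ℓ)
riemann-cauchy ℓ ε 0<ε = let N , h = archimedean ε 0<ε in N , λ m n N≤m N≤n →
  subst₂ (λ p q → ∣ p - q ∣ ≤ ε) (sym (riemann≡S ℓ m)) (sym (riemann≡S ℓ n))
    (∣p-q∣≤ (S ℓ (suc m)) (S ℓ (suc n)) (≤-trans (S-close ℓ m n) (h n N≤n)) (≤-trans (S-close ℓ n m) (h m N≤m)))

-- log n = ∫₁ⁿ dx/x, as the limit of its Riemann sums of mesh 1/1, 1/2, ….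
log : ∀ n → .{{ℕ.NonZero n}} → ℝ
log n = mkℝ (riemann recip 1ℚ (ℕ.pred n)) (riemann-cauchy (ℕ.pred n))

instance
  nonTrivial⇒nonZero : ∀ {n} → .{{ℕ.NonTrivial n}} → ℕ.NonZero n
  nonTrivial⇒nonZero {n} = ℕ.nonTrivial⇒nonZero n

0<log : ∀ n → .{{_ : ℕ.NonTrivial n}} → 0ℝ <ℝ log n
0<log n@(suc (suc l)) = u 1 , 0<u 1 , 0 , λ k _ →
  subst₂ _≤_ (sym (+-identityˡ (u 1))) (sym (riemann≡S (suc l) k))
    (≤-trans u1≤S (subst (λ p → S (suc l) 1 ≤ S (suc l) p) (ℕₚ.*-identityˡ (suc k))
                         (S-refine-≥ (suc l) 1 k)))
  where
  0≤∑ : ∀ N (f : ℕ → ℚ) → (∀ i → 0ℚ ≤ f i) → 0ℚ ≤ ∑< N f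
  0≤∑ zero    f h = ≤-refl
  0≤∑ (suc N) f h = +-mono-≤ (0≤∑ N f h) (h N)
  u1≤S : u 1 ≤ S (suc l) 1
  u1≤S = subst (u 1 ≤_) (sym (∑<-split 1 (l ℕ.* 1) (λ i → u (1 ℕ.+ i))))
    (subst (_≤ ∑< 1 (λ i → u (1 ℕ.+ i)) + ∑< (l ℕ.* 1) (λ i → u (1 ℕ.+ (1 ℕ.+ i))))
           (+-identityˡ (u 1))
           (p≤p+q (0≤∑ (l ℕ.* 1) _ λ i → <⇒≤ (0<u (1 ℕ.+ (1 ℕ.+ i))))))

log^ : ℤ → ∀ n → .{{ℕ.NonTrivial n}} → ℝ
log^ j n = zpow (log n) (0<log n) j

IsCauchyℝ : (ℕ → ℝ) → Set
IsCauchyℝ x = ∀ ε → 0ℚ < ε →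
  ∃ λ N → ∀ m n → N ℕ.≤ m → N ℕ.≤ n → ∣ x m -ℝ x n ∣ℝ ≤ℝ fromℚ ε

-- The nth rational approximation of the limit is within 1 / (n + 1) of x n.
lim : (x : ℕ → ℝ) → IsCauchyℝ x → ℝ
lim x cx = mkℝ a proof
  where
  M : ℕ → ℕ
  M n = proj₁ (cauchy (x n) (u n) (0<u n))
  a : ℕ → ℚ
  a n = seq (x n) (M n)
  close : ∀ n k → M n ℕ.≤ k → ∣ a n - seq (x n) k ∣ ≤ u n
  close n k = proj₂ (cauchy (x n) (u n) (0<u n)) (M n) k ℕₚ.≤-refl
  quarters : ∀ ε → ½ * (½ * ε) + ((½ * (½ * ε) + ½ * (½ * ε)) + ½ * (½ * ε)) ≡ ε
  quarters = solve 1 (λ ε → con ½ :* (con ½ :* ε) :+ ((con ½ :* (con ½ :* ε) :+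
               con ½ :* (con ½ :* ε)) :+ con ½ :* (con ½ :* ε)) := ε) refl
    where open +-*-Solver
  proof′ : ∀ {ε} η → 0ℚ < η → η + ((η + η) + η) ≡ ε →
           ∃ λ N → ∀ m n → N ℕ.≤ m → N ℕ.≤ n → ∣ a m - a n ∣ ≤ ε
  proof′ η 0<η eq =
    let N₁ , h₁ = archimedean η 0<η
        N₂ , h₂ = cx η 0<η
    in N₁ ℕ.⊔ N₂ , λ m n N≤m N≤n →
      let K , h₃ = h₂ m n (ℕₚ.m⊔n≤o⇒n≤o N₁ N₂ N≤m) (ℕₚ.m⊔n≤o⇒n≤o N₁ N₂ N≤n) η 0<η
          k   = (M m ℕ.⊔ M n) ℕ.⊔ K
          M≤k = ℕₚ.m≤m⊔n (M m ℕ.⊔ M n) K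
          b   = seq (x m) k
          c   = seq (x n) k
      in subst (∣ a m - a n ∣ ≤_) eq
        (≤-trans (∣p-r∣≤∣p-q∣+∣q-r∣ (a m) b (a n))
        (+-mono-≤
          (≤-trans (close m k (ℕₚ.m⊔n≤o⇒m≤o (M m) (M n) M≤k))
                   (h₁ m (ℕₚ.m⊔n≤o⇒m≤o N₁ N₂ N≤m)))
          (≤-trans (∣p-r∣≤∣p-q∣+∣q-r∣ b c (a n))
          (+-mono-≤
            (h₃ k (ℕₚ.m≤n⊔m (M m ℕ.⊔ M n) K))
            (subst (_≤ η) (∣p-q∣≡∣q-p∣ (a n) c)
              (≤-trans (close n k (ℕₚ.m⊔n≤o⇒n≤o (M m) (M n) M≤k))
                       (h₁ n (ℕₚ.m⊔n≤o⇒m≤o N₁ N₂ N≤n))))))))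
  proof : IsCauchy a
  proof ε 0<ε = proof′ (½ * (½ * ε)) (0<½p (0<½p 0<ε)) (quarters ε)

H-log : ℕ → ℝ
H-log n = fromℚ (H (suc n)) -ℝ log (suc n)

H-log-cauchy : IsCauchyℝ H-log
H-log-cauchy ε 0<ε = let N , h = archimedean ε 0<ε in N , λ m n N≤m N≤n δ 0<δ →
  0 , λ k _ → ≤-trans
    (subst₂ (λ p q → ∣ p - q ∣ ≤ ε) (sym (seq≡g m k)) (sym (seq≡g n k))
      (∣p-q∣≤ (g k m) (g k n) (gap k m n (h m N≤m)) (gap k n m (h n N≤n))))
    (p≤p+q (<⇒≤ 0<δ))
  where
  g : ℕ → ℕ → ℚ
  g k n = H (suc n) - S n (suc k)
  seq≡g : ∀ n k → seq (H-log n) k ≡ g k n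
  seq≡g n k = cong (λ t → H (suc n) - t) (riemann≡S n k)
  S-suc : ∀ k n → S (suc n) (suc k) ≡ S n (suc k) + block (suc k) (suc n)
  S-suc k n = trans (cong (λ N → ∑< N (λ i → u (suc k ℕ.+ i))) (ℕₚ.+-comm (suc k) (n ℕ.* suc k)))
    (trans (∑<-split (n ℕ.* suc k) (suc k) _)
    (cong (λ t → S n (suc k) + t) (∑<-cong (suc k) λ j →
      cong u (sym (ℕₚ.+-assoc (suc k) (n ℕ.* suc k) j)))))
  antitone : (f : ℕ → ℚ) → (∀ n → f (suc n) ≤ f n) → ∀ m d → f (d ℕ.+ m) ≤ f m
  antitone f step m zero    = ≤-refl
  antitone f step m (suc d) = ≤-trans (step (d ℕ.+ m)) (antitone f step m d)
  anti-≤ : (f : ℕ → ℚ) → (∀ n → f (suc n) ≤ f n) → ∀ {m n} → m ℕ.≤ n → f n ≤ f m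
  anti-≤ f step {m} {n} m≤n =
    subst (λ t → f t ≤ f m) (ℕₚ.m∸n+n≡m m≤n) (antitone f step m (n ℕ.∸ m))
  g-step : ∀ k n → g k (suc n) ≤ g k n
  g-step k n = subst₂ _≤_
    (trans (lem (H (suc n)) (S n (suc k)) (u (suc n)) (block (suc k) (suc n)))
           (cong (λ t → H (suc (suc n)) - t) (sym (S-suc k n))))
    (trans (cong (λ t → g k n + t) (+-inverseʳ (block (suc k) (suc n)))) (+-identityʳ (g k n)))
    (+-monoʳ-≤ (g k n) (+-monoˡ-≤ (- block (suc k) (suc n)) (u≤block k (suc n))))
    where
    open +-*-Solver
    lem : ∀ h s v b → (h - s) + (v - b) ≡ (h + v) - (s + b)
    lem = solve 4 (λ h s v b → (h :- s) :+ (v :- b) := (h :+ v) :- (s :+ b)) refl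
  ug-step : ∀ k n → u (suc n) - g k (suc n) ≤ u n - g k n
  ug-step k n = subst (_≤ u n - g k n)
    (trans (lem (H (suc n)) (S n (suc k)) (u (suc n)) (block (suc k) (suc n)))
           (cong (λ t → u (suc n) - (H (suc (suc n)) - t)) (sym (S-suc k n))))
    (+-monoˡ-≤ (- g k n) (block≤u k n))
    where
    open +-*-Solver
    lem : ∀ h s v b → b - (h - s) ≡ v - ((h + v) - (s + b))
    lem = solve 4 (λ h s v b → b :- (h :- s) := v :- ((h :+ v) :- (s :+ b))) refl
  gap : ∀ k m n → u m ≤ ε → g k m - g k n ≤ ε
  gap k m n um≤ε with ℕₚ.≤-total m n
  ... | inj₂ n≤m = p≤q+r⇒p-q≤r (g k m) (g k n)
    (≤-trans (anti-≤ (g k) (g-step k) n≤m) (p≤p+q (<⇒≤ 0<ε)))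
  ... | inj₁ m≤n = p≤q+r⇒p-q≤r (g k m) (g k n) (≤-trans
    (subst₂ _≤_ (lem₁ (g k m) (u m)) (lem₂ (g k n) (u m) (u n))
      (+-monoˡ-≤ (u m) (neg-≤ {u n} {g k n} {u m} {g k m} (anti-≤ (λ i → u i - g k i) (ug-step k) m≤n))))
    (+-monoʳ-≤ (g k n) (≤-trans (subst (u m - u n ≤_) (+-identityʳ (u m))
      (+-monoʳ-≤ (u m) (<⇒≤ (neg-antimono-< (0<u n))))) um≤ε)))
    where
    open +-*-Solver
    neg-≤ : ∀ {a b c d} → a - b ≤ c - d → d - c ≤ b - a
    neg-≤ {a} {b} {c} {d} h = subst₂ _≤_ (neg-sub c d) (neg-sub a b) (neg-antimono-≤ h)
    lem₁ : ∀ a b → (a - b) + b ≡ a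
    lem₁ = solve 2 (λ a b → (a :- b) :+ b := a) refl
    lem₂ : ∀ a b c → (a - c) + b ≡ a + (b - c)
    lem₂ = solve 3 (λ a b c → (a :- c) :+ b := a :+ (b :- c)) refl

-- γ = lim (1 + 1/2 + ⋯ + 1/n − log n), with n ≥ 1 shifted to start at 0.
γ : ℝ
γ = lim H-log H-log-cauchy

{-# OPTIONS --safe #-}

-- Deleting the point 0 from a permutation of n + 1 points leaves a permutation
-- of n points, with one cycle fewer if 0 was fixed and equally many cycles
-- otherwise; since 0 can be reinserted after any of the n points, this gives
--   βₛ₊₁(n + 1) = βₛ₊₁(n) + (s + 1)/(n + 1) βₛ(n),
-- so βₛ(n) = s! eₛ(1, 1/2, …, 1/n).  Induction on n then yields
--   0 ≤ Hₙ βₛ₊₁(n) − βₛ₊₂(n) ≤ (s + 1) (1 + 1/4 + ⋯ + 1/n²) βₛ(n),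
-- whence βₛ(n) = Hₙˢ + O(Hₙˢ⁻²).  Finally Hₙ = log n + γ + O(1/n), and the
-- power is expanded to first order in Hₙ − log n ∈ [0 , 1].
module Submission where

open import Defs
open import Algebra.Bundles using (module CommutativeRing)
open import Data.Bool.Base using (T; true; false; if_then_else_)
open import Data.Fin.Base as Fin using (Fin; zero; suc; toℕ; finToFun; funToFin)
open import Data.Fin.Permutation.Components using (transpose)
import Data.Fin.Properties as Finₚ
open import Data.Integer.Base as ℤ using (+_)
open import Data.List.Base as List
  using (List; []; _∷_; allFin; cartesianProductWith; deduplicate; filter; length; lookup; map)
open import Data.List.Membership.Propositional using (_∈_)
open import Data.List.Membership.Propositional.Properties
open import Data.List.Membership.Propositional.Properties.WithK using (unique∧set⇒bag)
import Data.List.Properties as Listₚ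
open import Data.List.Relation.Binary.BagAndSetEquality using (∼bag⇒↭)
open import Data.List.Relation.Binary.Permutation.Propositional using (_↭_)
open import Data.List.Relation.Binary.Permutation.Propositional.Properties using (map⁺)
open import Data.List.Relation.Unary.All as All using ([]; _∷_)
import Data.List.Relation.Unary.All.Properties as Allₚ
open import Data.List.Relation.Unary.AllPairs as AllPairs using (AllPairs; []; _∷_)
import Data.List.Relation.Unary.AllPairs.Properties as AllPairsₚ
open import Data.List.Relation.Unary.Any as Any using (Any; here; there)
import Data.List.Relation.Unary.Any.Properties as Anyₚ
import Data.List.Relation.Unary.Unique.DecSetoid.Properties as DecUnique
open import Data.List.Relation.Unary.Unique.Propositional using (Unique)
import Data.List.Relation.Unary.Unique.Propositional.Properties as Uniqueₚ
open import Data.Nat.Base as ℕ using (ℕ; zero; suc; _!)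
open import Data.Nat.Combinatorics using (_P_)
open import Data.Nat.Combinatorics.Base using (_P′_)
open import Data.Nat.Combinatorics.Specification using (P′-rec; k>n⇒nPk≡0)
open import Data.Nat.Coprimality using (1-coprimeTo)
open import Data.Nat.GeneralisedArithmetic using (iterate)
open import Data.Nat.ListAction using (sum)
open import Data.Nat.ListAction.Properties using (sum-++; sum-↭)
import Data.Nat.Properties as ℕₚ
open import Data.Nat.Solver using () renaming (module +-*-Solver to ℕ-Solver)
open import Data.Product.Base using (∃; _×_; _,_; proj₁; proj₂)
open import Function.Base using (_∘_)
open import Function.Bundles using (mk⇔)
open import Function.Definitions using (Bijective; Injective)
open import Level using (0ℓ)
open import Relation.Binary.Bundles using (DecSetoid)
open import Relation.Binary.PropositionalEquality
open import Relation.Nullary using (¬_; Dec; yes; no; does; contradiction)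
open import Relation.Nullary.Decidable using (dec-true; dec-false)
open import Relation.Unary using (Decidable)

-- Why Hₙ βₛ₊₁ nearly equals βₛ₊₂: multiplying eₛ₊₁(1, 1/2, ..., 1/n) by e₁ = Hₙ gives (s + 2) eₛ₊₂
-- from the new indices, and from each repeated index i the factor 1/i² times a part of eₛ.
-- Symmetric functions never appear in the code: the inequality is obtained from the recurrence in
-- n, the difference of its two sides being an explicit nonnegative combination of earlier
-- instances.
--
-- Two obstacles shape the rest. Functions agree only pointwise, so a permutation is handled through
-- its code in `Fin (n ^ n)`, where lists can be compared up to rearrangement. And real inequalities
-- are proved by bounding the k-th rational approximants for all k ≥ n - 1, so every estimate
-- concerns rationals `L` and `g` that stand near log n and γ. The approximant of γ differs from Hₙ
-- - L by at most 4/n; since L ≤ n, this error times Lˢ⁻¹ is O(Lˢ⁻²), which the error term can take.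

private
  variable
    n : ℕ

-- Cycles as equivalence classes, and their systems of representatives

SameCycle-trans : (σ : Fin n → Fin n) → ∀ {i j k} →
                  SameCycle σ i j → SameCycle σ j k → SameCycle σ i k
SameCycle-trans σ {i} (a , refl) (b , refl) = a ℕ.+ b , iterate-+ σ i a b

module _ {σ : Fin n → Fin n} (σ-inj : Injective _≡_ _≡_ σ) where

  iterate-injective : ∀ k {i j} → iterate σ i k ≡ iterate σ j k → i ≡ j
  iterate-injective zero    eq = eq
  iterate-injective (suc k) eq = σ-inj (iterate-injective k eq)

  SameCycle-back : ∀ i → SameCycle σ (σ i) i
  SameCycle-back i
    with a , b , a<b , eq ← Finₚ.pigeonhole (ℕₚ.n<1+n n) (iterate σ i ∘ toℕ {suc n})
    -- Here `a<b` is `suc a ≤ b`, so `p` is b - a - 1: a full return to `i` takes p + 1 steps, and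
    -- the walk below has already made the first one.
    with p , a+p≡b ← ℕₚ.m≤n⇒∃[o]m+o≡n a<b
    = p , sym (iterate-injective (toℕ a) (begin
        iterate σ i (toℕ a)                    ≡⟨ eq ⟩
        iterate σ i (toℕ b)                    ≡⟨ cong (iterate σ i) a+p≡b ⟨
        iterate σ (σ i) (toℕ a ℕ.+ p)          ≡⟨ cong (iterate σ (σ i)) (ℕₚ.+-comm (toℕ a) p) ⟩
        iterate σ (σ i) (p ℕ.+ toℕ a)          ≡⟨ iterate-+ σ (σ i) p (toℕ a) ⟩
        iterate σ (iterate σ (σ i) p) (toℕ a)  ∎))
    where open ≡-Reasoning

  SameCycle-sym : ∀ {i j} → SameCycle σ i j → SameCycle σ j i
  SameCycle-sym (zero  , refl) = zero , refl
  SameCycle-sym {i} (suc k , eq) =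
    SameCycle-trans σ (SameCycle-sym (k , eq)) (SameCycle-back i)

  sameCycleDecSetoid : DecSetoid 0ℓ 0ℓ
  sameCycleDecSetoid = record
    { isDecEquivalence = record
      { isEquivalence = record
        { refl  = 0 , refl
        ; sym   = SameCycle-sym
        ; trans = SameCycle-trans σ
        }
      ; _≟_ = sameCycle? σ
      }
    }

Transversal : (Fin n → Fin n) → List (Fin n) → Set
Transversal σ xs =
  AllPairs (λ i j → ¬ SameCycle σ i j) xs × (∀ i → Any (λ x → SameCycle σ x i) xs)

module _ {σ : Fin n → Fin n} (σ-inj : Injective _≡_ _≡_ σ) where

  lookup-≁ : ∀ {xs} → AllPairs (λ i j → ¬ SameCycle σ i j) xs →
             ∀ a b → SameCycle σ (lookup xs a) (lookup xs b) → a ≡ b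
  lookup-≁ {_ ∷ _} _  zero    zero    _ = refl
  lookup-≁ (x≁ ∷ _)   zero    (suc b) r = contradiction r (All.lookup x≁ (∈-lookup b))
  lookup-≁ (x≁ ∷ _)   (suc a) zero    r =
    contradiction (SameCycle-sym σ-inj r) (All.lookup x≁ (∈-lookup a))
  lookup-≁ (_ ∷ xs≁)  (suc a) (suc b) r = cong suc (lookup-≁ xs≁ a b r)

  -- Sending each element of `xs` to its representative in `ys` is injective, because two elements
  -- with a common representative share a cycle.
  Transversal-length-≤ : ∀ {xs ys} → Transversal σ xs → Transversal σ ys →
                         length xs ℕ.≤ length ys
  Transversal-length-≤ {xs} {ys} (xs≁ , _) (_ , ys-cover) =
    Finₚ.injective⇒≤ {f = rep} λ {a} {b} eq → lookup-≁ xs≁ a b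
      (SameCycle-trans σ (SameCycle-sym σ-inj (rep-∼ a))
        (subst (λ c → SameCycle σ (lookup ys c) (lookup xs b)) (sym eq) (rep-∼ b)))
    where
    rep : Fin (length xs) → Fin (length ys)
    rep a = Any.index (ys-cover (lookup xs a))
    rep-∼ : ∀ a → SameCycle σ (lookup ys (rep a)) (lookup xs a)
    rep-∼ a = Anyₚ.lookup-index (ys-cover (lookup xs a))

  cycles-Transversal : Transversal σ (deduplicate (sameCycle? σ) (allFin n))
  cycles-Transversal = DecUnique.deduplicate-! (sameCycleDecSetoid σ-inj) (allFin n) ,
    λ i → Anyₚ.deduplicate⁺ (sameCycle? σ) (λ r s → SameCycle-trans σ r s)
            (Any.map (λ { refl → 0 , refl }) (∈-allFin i))

  -- Frees the count from the representatives that `deduplicate` happens to keep: from here on any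
  -- convenient transversal computes `cycles`.
  Transversal⇒cycles : ∀ {xs} → Transversal σ xs → cycles σ ≡ length xs
  Transversal⇒cycles t = ℕₚ.≤-antisym (Transversal-length-≤ cycles-Transversal t)
                                      (Transversal-length-≤ t cycles-Transversal)

Transversal-resp : ∀ {σ τ : Fin n → Fin n} →
  (∀ {i j} → SameCycle σ i j → SameCycle τ i j) →
  (∀ {i j} → SameCycle τ i j → SameCycle σ i j) →
  ∀ {xs} → Transversal σ xs → Transversal τ xs
Transversal-resp f g (≁ , cover) = AllPairs.map (_∘ g) ≁ , Any.map f ∘ cover

SameCycle-resp-≗ : ∀ {σ τ : Fin n → Fin n} → σ ≗ τ → ∀ {i j} → SameCycle σ i j → SameCycle τ i j
SameCycle-resp-≗ {σ = σ} {τ} σ≗τ {i} (k , refl) = k , sym (iterate-cong k i)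
  where
  iterate-cong : ∀ k i → iterate σ i k ≡ iterate τ i k
  iterate-cong zero    i = refl
  iterate-cong (suc k) i = trans (iterate-cong k (σ i)) (cong (λ j → iterate τ j k) (σ≗τ i))

Bijective-resp-≗ : ∀ {σ τ : Fin n → Fin n} → σ ≗ τ → Bijective _≡_ _≡_ σ → Bijective _≡_ _≡_ τ
Bijective-resp-≗ eq (inj , surj) =
  (λ {x} {y} h → inj (trans (eq x) (trans h (sym (eq y))))) ,
  λ y → let x , h = surj y in x , λ { refl → trans (sym (eq x)) (h refl) }

cycles-cong : ∀ {σ τ : Fin n → Fin n} → Bijective _≡_ _≡_ σ → σ ≗ τ → cycles σ ≡ cycles τ
cycles-cong bij eq = sym (Transversal⇒cycles (proj₁ (Bijective-resp-≗ eq bij))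
  (Transversal-resp (SameCycle-resp-≗ eq) (SameCycle-resp-≗ (sym ∘ eq))
    (cycles-Transversal (proj₁ bij))))

-- Inserting and deleting the point `zero`

lift : (Fin n → Fin n) → Fin (suc n) → Fin (suc n)
lift = Fin.lift 1

-- extend zero τ adds the fixed point zero to τ; extend (suc j) τ inserts
-- zero immediately after j in the cycle of j.
extend : Fin (suc n) → (Fin n → Fin n) → Fin (suc n) → Fin (suc n)
extend c τ = lift τ ∘ transpose zero c

transpose-≢ : ∀ {i j k : Fin n} → k ≢ i → k ≢ j → transpose i j k ≡ k
transpose-≢ {i = i} {j} {k} k≢i k≢j
  rewrite dec-false (k Finₚ.≟ i) k≢i | dec-false (k Finₚ.≟ j) k≢j = refl

transpose-target : ∀ (i j : Fin n) → transpose i j j ≡ i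
transpose-target i j with j Finₚ.≟ i
... | yes j≡i = j≡i
... | no  _ rewrite dec-true (j Finₚ.≟ j) refl = refl

transpose-involutive : ∀ (i j : Fin n) k → transpose i j (transpose i j k) ≡ k
transpose-involutive i j k with k Finₚ.≟ i
... | yes refl = transpose-target k j
... | no k≢i with k Finₚ.≟ j
...   | yes refl rewrite dec-true (i Finₚ.≟ i) refl = refl
...   | no k≢j = transpose-≢ k≢i k≢j

lift-Bijective : ∀ {τ : Fin n → Fin n} → Bijective _≡_ _≡_ τ → Bijective _≡_ _≡_ (lift τ)
lift-Bijective {n} {τ} (inj , surj) = Finₚ.lift-injective τ inj 1 , surj′
  where
  surj′ : ∀ y → ∃ λ x → ∀ {z} → z ≡ x → lift τ z ≡ y
  surj′ zero    = zero , λ { refl → refl }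
  surj′ (suc y) = let x , h = surj y in suc x , λ { refl → cong suc (h refl) }

∘transpose-Bijective : ∀ {σ : Fin n → Fin n} i j → Bijective _≡_ _≡_ σ →
                       Bijective _≡_ _≡_ (σ ∘ transpose i j)
∘transpose-Bijective {σ = σ} i j (inj , surj) =
  (λ {x} {y} eq → trans (sym (transpose-involutive i j x))
                  (trans (cong (transpose i j) (inj eq)) (transpose-involutive i j y))) ,
  λ y → let x , h = surj y in
    transpose i j x , λ { refl → trans (cong σ (transpose-involutive i j x)) (h refl) }

extend-Bijective : ∀ c {τ : Fin n → Fin n} → Bijective _≡_ _≡_ τ → Bijective _≡_ _≡_ (extend c τ)
extend-Bijective c bij = ∘transpose-Bijective zero c (lift-Bijective bij)

extend-source : ∀ (c : Fin (suc n)) τ → extend c τ c ≡ zero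
extend-source c τ = cong (lift τ) (transpose-target zero c)

extend≡zero : ∀ {c d : Fin (suc n)} τ → extend c τ d ≡ zero → d ≡ c
extend≡zero {c = c} {d} τ eq = trans (sym (transpose-involutive zero c d))
  (cong (transpose zero c) (lift≡zero (transpose zero c d) eq))
  where
  lift≡zero : ∀ i → lift τ i ≡ zero → i ≡ zero
  lift≡zero zero _ = refl

-- The preimage of `zero` determines `c`; cancelling the common transposition then recovers τ.
extend-injective : ∀ {c d} {τ ρ : Fin n → Fin n} → extend c τ ≗ extend d ρ → c ≡ d × τ ≗ ρ
extend-injective {c = c} {d} {τ} {ρ} eq
  with refl ← extend≡zero {c = d} {c} ρ (trans (sym (eq c)) (extend-source c τ))
  = refl , λ i → Finₚ.suc-injective
      (trans (sym (unfold τ i)) (trans (eq (transpose zero c (suc i))) (unfold ρ i)))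
  where
  unfold : ∀ σ i → extend c σ (transpose zero c (suc i)) ≡ suc (σ i)
  unfold σ i = cong (lift σ) (transpose-involutive zero c (suc i))

-- With `c` the preimage of `zero` under σ, the composite of σ with the transposition fixes `zero`,
-- and its restriction to the other points is τ.
extend-surjective : ∀ {σ : Fin (suc n) → Fin (suc n)} → Bijective _≡_ _≡_ σ →
                    ∃ λ c → ∃ λ τ → Bijective _≡_ _≡_ τ × extend c τ ≗ σ
extend-surjective {n} {σ} bij@(_ , surj) with c , σc≡0 ← surj zero =
  c , τ , (τ-inj , τ-surj) , λ i →
    trans (lift-τ (transpose zero c i)) (cong σ (transpose-involutive zero c i))
  where
  ρ : Fin (suc n) → Fin (suc n)
  ρ = σ ∘ transpose zero c
  ρ-bij : Bijective _≡_ _≡_ ρ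
  ρ-bij = ∘transpose-Bijective zero c bij
  ρ0≡0 : ρ zero ≡ zero
  ρ0≡0 = σc≡0 refl
  0≢ρ : ∀ i → zero ≢ ρ (suc i)
  0≢ρ i 0≡ρi with () ← proj₁ ρ-bij {zero} {suc i} (trans ρ0≡0 0≡ρi)
  τ : Fin n → Fin n
  τ i = Fin.punchOut (0≢ρ i)
  suc-τ : ∀ i → suc (τ i) ≡ ρ (suc i)
  suc-τ i = Finₚ.punchIn-punchOut (0≢ρ i)
  lift-τ : ∀ i → lift τ i ≡ ρ i
  lift-τ zero    = sym ρ0≡0
  lift-τ (suc i) = suc-τ i
  τ-inj : Injective _≡_ _≡_ τ
  τ-inj {x} {y} eq = Finₚ.suc-injective (proj₁ ρ-bij {suc x} {suc y}
    (trans (sym (suc-τ x)) (trans (cong suc eq) (suc-τ y))))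
  τ-surj : ∀ y → ∃ λ x → ∀ {z} → z ≡ x → τ z ≡ y
  τ-surj y with proj₂ ρ-bij (suc y)
  ... | zero  , h with () ← trans (sym ρ0≡0) (h refl)
  ... | suc x , h = x , λ { refl → Finₚ.suc-injective (trans (suc-τ x) (h refl)) }

-- Effect of the insertion on the number of cycles

module _ {τ : Fin n → Fin n} where

  extend-zero-SameCycle : ∀ {i j} → SameCycle τ i j →
                          SameCycle (extend zero τ) (suc i) (suc j)
  extend-zero-SameCycle {i} (k , refl) = k , go k i
    where
    go : ∀ k i → iterate (extend zero τ) (suc i) k ≡ suc (iterate τ i k)
    go zero    i = refl
    go (suc k) i = go k (τ i)

  extend-zero-SameCycle⁻ : ∀ i x → SameCycle (extend zero τ) (suc i) x →
                           ∃ λ j → x ≡ suc j × SameCycle τ i j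
  extend-zero-SameCycle⁻ i x (zero  , refl) = i , refl , 0 , refl
  extend-zero-SameCycle⁻ i x (suc k , eq)   =
    let j , x≡ , l , eq′ = extend-zero-SameCycle⁻ (τ i) x (k , eq) in j , x≡ , suc l , eq′

  extend-zero-Transversal : ∀ {xs} → Transversal τ xs →
                            Transversal (extend zero τ) (zero ∷ map suc xs)
  extend-zero-Transversal (≁ , cover) =
    (Allₚ.map⁺ (All.universal (λ i r → zero-alone (proj₁ r) i (proj₂ r)) _) ∷
     AllPairsₚ.map⁺ (AllPairs.map
       (λ {i} {j} ¬r r → no-SameCycle ¬r (extend-zero-SameCycle⁻ i (suc j) r)) ≁)) ,
    λ where
      zero    → here (0 , refl)
      (suc i) → there (Anyₚ.map⁺ (Any.map extend-zero-SameCycle (cover i)))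
    where
    zero-alone : ∀ k i → iterate (extend zero τ) zero k ≢ suc i
    zero-alone (suc k) i = zero-alone k i
    no-SameCycle : ∀ {i j} → ¬ SameCycle τ i j → ¬ (∃ λ l → suc j ≡ suc l × SameCycle τ i l)
    no-SameCycle ¬r (_ , refl , r) = ¬r r

  module _ (j : Fin n) where

    extend-suc-at : extend (suc j) τ (suc j) ≡ zero
    extend-suc-at = extend-source (suc j) τ

    extend-suc-≢ : ∀ {i} → i ≢ j → extend (suc j) τ (suc i) ≡ suc (τ i)
    extend-suc-≢ i≢j = cong (lift τ) (transpose-≢ {i = zero} (λ ()) (i≢j ∘ Finₚ.suc-injective))

    -- One step of τ from `j` becomes two, since the new cycle makes a detour through `zero`.
    extend-suc-step : ∀ i → SameCycle (extend (suc j) τ) (suc i) (suc (τ i))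
    extend-suc-step i with i Finₚ.≟ j
    ... | yes refl = 2 , cong (extend (suc j) τ) extend-suc-at
    ... | no i≢j   = 1 , extend-suc-≢ i≢j

    extend-suc-SameCycle : ∀ {i l} → SameCycle τ i l →
                           SameCycle (extend (suc j) τ) (suc i) (suc l)
    extend-suc-SameCycle     (zero  , refl) = 0 , refl
    extend-suc-SameCycle {i} (suc k , eq)   = SameCycle-trans (extend (suc j) τ)
      (extend-suc-step i) (extend-suc-SameCycle (k , eq))

    -- The walk may visit `zero`, which is no point of τ. Since `zero` is sent to `suc (τ j)`, a
    -- walk standing there is treated as if it still stood at `j`; hence the two mutually recursive
    -- statements.
    extend-suc-SameCycle⁻ : ∀ k {i l} → iterate (extend (suc j) τ) (suc i) k ≡ suc l →
                            SameCycle τ i l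
    extend-suc-SameCycle⁻-zero : ∀ k {l} → iterate (extend (suc j) τ) zero k ≡ suc l →
                                 SameCycle τ j l

    extend-suc-SameCycle⁻ zero            refl = 0 , refl
    extend-suc-SameCycle⁻ (suc k) {i} {l} eq   = split (i Finₚ.≟ j)
      where
      after : ∀ {x} → extend (suc j) τ (suc i) ≡ x → iterate (extend (suc j) τ) x k ≡ suc l
      after refl = eq
      split : Dec (i ≡ j) → SameCycle τ i l
      split (no i≢j)   = let m , eq′ = extend-suc-SameCycle⁻ k (after (extend-suc-≢ i≢j))
                         in suc m , eq′
      split (yes refl) = extend-suc-SameCycle⁻-zero k (after extend-suc-at)

    extend-suc-SameCycle⁻-zero (suc k) eq =
      let m , eq′ = extend-suc-SameCycle⁻ k eq in suc m , eq′

    extend-suc-Transversal : ∀ {xs} → Transversal τ xs →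
                             Transversal (extend (suc j) τ) (map suc xs)
    extend-suc-Transversal (≁ , cover) =
      AllPairsₚ.map⁺ (AllPairs.map (λ ¬r (k , eq) → ¬r (extend-suc-SameCycle⁻ k eq)) ≁) ,
      λ where
        zero    → Anyₚ.map⁺ (Any.map (λ r → SameCycle-trans (extend (suc j) τ)
                    (extend-suc-SameCycle r) (1 , extend-suc-at)) (cover j))
        (suc i) → Anyₚ.map⁺ (Any.map extend-suc-SameCycle (cover i))

module _ {τ : Fin n → Fin n} (bij : Bijective _≡_ _≡_ τ) where

  cycles-extend-zero : cycles (extend zero τ) ≡ suc (cycles τ)
  cycles-extend-zero = trans
    (Transversal⇒cycles (proj₁ (extend-Bijective zero bij))
      (extend-zero-Transversal (cycles-Transversal (proj₁ bij))))
    (cong suc (Listₚ.length-map suc (deduplicate (sameCycle? τ) (allFin n))))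

  cycles-extend-suc : ∀ j → cycles (extend (suc j) τ) ≡ cycles τ
  cycles-extend-suc j = trans
    (Transversal⇒cycles (proj₁ (extend-Bijective (suc j) bij))
      (extend-suc-Transversal j (cycles-Transversal (proj₁ bij))))
    (Listₚ.length-map suc (deduplicate (sameCycle? τ) (allFin n)))

-- Sums over permutations by way of their codes

codes : ∀ n → List (Fin (n ℕ.^ n))
codes n = filter (bijective? ∘ finToFun {n} {n}) (allFin (n ℕ.^ n))

filter-map : ∀ {A B : Set} {P : B → Set} (P? : Decidable P) (f : A → B) xs →
             filter P? (map f xs) ≡ map f (filter (P? ∘ f) xs)
filter-map P? f []       = refl
filter-map P? f (x ∷ xs) with does (P? (f x))
... | true  = cong (f x ∷_) (filter-map P? f xs)
... | false = filter-map P? f xs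

codes-Unique : ∀ n → Unique (codes n)
codes-Unique n = Uniqueₚ.filter⁺ (bijective? ∘ finToFun {n} {n}) (Uniqueₚ.allFin⁺ (n ℕ.^ n))

∈-codes⁺ : ∀ n i → Bijective _≡_ _≡_ (finToFun {n} {n} i) → i ∈ codes n
∈-codes⁺ n i = ∈-filter⁺ (bijective? ∘ finToFun {n} {n}) (∈-allFin i)

∈-codes⁻ : ∀ n i → i ∈ codes n → Bijective _≡_ _≡_ (finToFun {n} {n} i)
∈-codes⁻ n i = proj₂ ∘ ∈-filter⁻ (bijective? ∘ finToFun {n} {n}) {xs = allFin (n ℕ.^ n)}

extendCode : ∀ n → Fin (suc n) → Fin (n ℕ.^ n) → Fin (suc n ℕ.^ suc n)
extendCode n c i = funToFin (extend c (finToFun {n} {n} i))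

extendCode-≗ : ∀ n c i → extend c (finToFun {n} {n} i) ≗ finToFun (extendCode n c i)
extendCode-≗ n c i = sym ∘ Finₚ.finToFun-funToFin (extend c (finToFun {n} {n} i))

funToFin-cong : ∀ {m n} {f g : Fin m → Fin n} → f ≗ g → funToFin f ≡ funToFin g
funToFin-cong {zero}  eq = refl
funToFin-cong {suc m} eq = cong₂ Fin.combine (eq zero) (funToFin-cong (eq ∘ suc))

finToFun-injective : ∀ m n {i j} → finToFun {n} {m} i ≗ finToFun {n} {m} j → i ≡ j
finToFun-injective m n {i} {j} eq = trans (sym (Finₚ.funToFin-finToFin {m} {n} i))
  (trans (funToFin-cong eq) (Finₚ.funToFin-finToFin {m} {n} j))

∑codes : ∀ n → (ℕ → ℕ) → ℕ
∑codes n f = sum (map (f ∘ cycles ∘ finToFun {n} {n}) (codes n))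

∑perms≡∑codes : ∀ n f → sum (map (f ∘ cycles) (perms n)) ≡ ∑codes n f
∑perms≡∑codes n f = cong sum (trans
  (cong (map (f ∘ cycles)) (filter-map bijective? (finToFun {n} {n}) (allFin (n ℕ.^ n))))
  (sym (Listₚ.map-∘ (codes n))))

extendCode-injective : ∀ n {c d i j} → extendCode n c i ≡ extendCode n d j → c ≡ d × i ≡ j
extendCode-injective n {c} {d} {i} {j} eq =
  let c≡d , i≗j = extend-injective λ x → trans (extendCode-≗ n c i x)
                    (trans (cong (λ k → finToFun {suc n} {suc n} k x) eq) (sym (extendCode-≗ n d j x)))
  in c≡d , finToFun-injective n n i≗j

-- Both lists are free of repetitions and have the same members, so they are rearrangements of each
-- other and no explicit rearrangement is needed. Equality of members is where codes replace
-- functions.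
codes-suc : ∀ n → codes (suc n) ↭ cartesianProductWith (extendCode n) (allFin (suc n)) (codes n)
codes-suc n = ∼bag⇒↭ (unique∧set⇒bag
  (codes-Unique (suc n))
  (Uniqueₚ.cartesianProductWith⁺ (extendCode n) (extendCode-injective n)
    (Uniqueₚ.allFin⁺ (suc n)) (codes-Unique n))
  (mk⇔ to from))
  where
  product = cartesianProductWith (extendCode n) (allFin (suc n)) (codes n)

  to : ∀ {k} → k ∈ codes (suc n) → k ∈ product
  to {k} k∈ with c , τ , τ-bij , eq ← extend-surjective (∈-codes⁻ (suc n) k k∈) =
    subst (_∈ product) code≡ (∈-cartesianProductWith⁺ (extendCode n) (∈-allFin c)
      (∈-codes⁺ n (funToFin τ) (Bijective-resp-≗ (sym ∘ Finₚ.finToFun-funToFin τ) τ-bij)))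
    where
    lift-cong : ∀ {ρ σ : Fin n → Fin n} → ρ ≗ σ → lift ρ ≗ lift σ
    lift-cong eq zero    = refl
    lift-cong eq (suc i) = cong suc (eq i)
    code≡ : extendCode n c (funToFin τ) ≡ k
    code≡ = finToFun-injective (suc n) (suc n) λ i →
      trans (sym (extendCode-≗ n c (funToFin τ) i))
      (trans (lift-cong (Finₚ.finToFun-funToFin τ) (transpose zero c i)) (eq i))

  from : ∀ {k} → k ∈ product → k ∈ codes (suc n)
  from k∈ with c , i , _ , i∈ , refl ← ∈-cartesianProductWith⁻ (extendCode n) (allFin (suc n)) (codes n) k∈ =
    ∈-codes⁺ (suc n) _ (Bijective-resp-≗ (extendCode-≗ n c i)
      (extend-Bijective c (∈-codes⁻ n i i∈)))

sum-cartesianProductWith : ∀ {A B C : Set} (h : C → ℕ) (f : A → B → C) ys {t} xs →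
  (∀ x → x ∈ xs → sum (map (h ∘ f x) ys) ≡ t) →
  sum (map h (cartesianProductWith f xs ys)) ≡ length xs ℕ.* t
sum-cartesianProductWith h f ys []       eq = refl
sum-cartesianProductWith h f ys (x ∷ xs) eq = trans
  (cong sum (Listₚ.map-++ h (map (f x) ys) (cartesianProductWith f xs ys)))
  (trans (sum-++ (map h (map (f x) ys)) _)
    (cong₂ ℕ._+_ (trans (cong sum (sym (Listₚ.map-∘ ys))) (eq x (here refl)))
                 (sum-cartesianProductWith h f ys xs (λ x′ → eq x′ ∘ there))))

∑codes-cong : ∀ n {g h : Fin (n ℕ.^ n) → ℕ} →
  (∀ i → Bijective _≡_ _≡_ (finToFun {n} {n} i) → g i ≡ h i) →
  sum (map g (codes n)) ≡ sum (map h (codes n))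
∑codes-cong n eq = cong sum (map-cong-∈ (codes n) λ i → eq i ∘ ∈-codes⁻ n i)
  where
  map-cong-∈ : ∀ {A B : Set} {g h : A → B} xs → (∀ x → x ∈ xs → g x ≡ h x) → map g xs ≡ map h xs
  map-cong-∈ []       eq = refl
  map-cong-∈ (x ∷ xs) eq = cong₂ _∷_ (eq x (here refl)) (map-cong-∈ xs λ y → eq y ∘ there)

-- The list `allFin (suc n)` begins with `zero`, whose fibre adds a cycle and yields `f ∘ suc`; each
-- of the n other insertions preserves the number of cycles.
∑codes-suc : ∀ n f → ∑codes (suc n) f ≡ ∑codes n (f ∘ suc) ℕ.+ n ℕ.* ∑codes n f
∑codes-suc n f = begin
  sum (map h (codes (suc n)))
    ≡⟨ sum-↭ (map⁺ h (codes-suc n)) ⟩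
  sum (map h (cartesianProductWith (extendCode n) (allFin (suc n)) (codes n)))
    ≡⟨ cong sum (Listₚ.map-++ h (map (extendCode n zero) (codes n)) rest) ⟩
  sum (map h (map (extendCode n zero) (codes n)) List.++ map h rest)
    ≡⟨ sum-++ (map h (map (extendCode n zero) (codes n))) (map h rest) ⟩
  sum (map h (map (extendCode n zero) (codes n))) ℕ.+ sum (map h rest)
    ≡⟨ cong₂ ℕ._+_
         (trans (cong sum (sym (Listₚ.map-∘ (codes n))))
                (∑codes-cong n λ i bij → cong f
                  (trans (cycles-extendCode zero i bij) (cycles-extend-zero bij))))
         (trans (sum-cartesianProductWith h (extendCode n) (codes n) (List.tabulate suc) suc-fibre)
                (cong (ℕ._* ∑codes n f) (Listₚ.length-tabulate {n = n} suc))) ⟩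
  ∑codes n (f ∘ suc) ℕ.+ n ℕ.* ∑codes n f ∎
  where
  open ≡-Reasoning
  h : Fin (suc n ℕ.^ suc n) → ℕ
  h = f ∘ cycles ∘ finToFun {suc n} {suc n}
  rest : List (Fin (suc n ℕ.^ suc n))
  rest = cartesianProductWith (extendCode n) (List.tabulate suc) (codes n)
  cycles-extendCode : ∀ c i → Bijective _≡_ _≡_ (finToFun {n} {n} i) →
    cycles (finToFun {suc n} {suc n} (extendCode n c i)) ≡ cycles (extend c (finToFun {n} {n} i))
  cycles-extendCode c i bij = sym (cycles-cong (extend-Bijective c bij) (extendCode-≗ n c i))
  suc-fibre : ∀ c → c ∈ List.tabulate suc → sum (map (h ∘ extendCode n c) (codes n)) ≡ ∑codes n f
  suc-fibre c c∈ with j , refl ← ∈-tabulate⁻ c∈ = ∑codes-cong n λ i bij → cong f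
    (trans (cycles-extendCode (suc j) i bij) (cycles-extend-suc bij j))

-- Falling factorials and the recurrence of the moments

P≡P′ : ∀ {k s} → s ℕ.≤ k → k P s ≡ k P′ s
P≡P′ {k} {s} s≤k with s ℕ.≤ᵇ k in eq
... | true  = refl
... | false = contradiction (ℕₚ.≤⇒≤ᵇ s≤k) (subst T eq)

-- Pascal's rule multiplied by (s + 1)!. The cases separate the range where `_P_` is cut off to 0
-- from the range where it is the product `_P′_`.
suc-P-suc : ∀ k s → suc k P suc s ≡ suc s ℕ.* (k P s) ℕ.+ k P suc s
suc-P-suc k s with s ℕₚ.≤? k
... | no s≰k = trans (k>n⇒nPk≡0 (ℕ.s≤s k<s)) (sym (cong₂ ℕ._+_
    (trans (cong (suc s ℕ.*_) (k>n⇒nPk≡0 k<s)) (ℕₚ.*-zeroʳ (suc s)))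
    (k>n⇒nPk≡0 (ℕₚ.m<n⇒m<1+n k<s))))
  where k<s = ℕₚ.≰⇒> s≰k
... | yes s≤k = trans (P≡P′ (ℕ.s≤s s≤k)) (trans (P′-rec (ℕ.s≤s s≤k))
    (cong₂ ℕ._+_ (cong (suc s ℕ.*_) (sym (P≡P′ s≤k))) (sym P-suc)))
  where
  P-suc : k P suc s ≡ k P′ suc s
  P-suc with suc s ℕₚ.≤? k
  ... | yes s<k = P≡P′ s<k
  -- Only s = k remains, where the leading factor `k ∸ s` of the product vanishes.
  ... | no  s≮k = trans (k>n⇒nPk≡0 (ℕₚ.≰⇒> s≮k))
    (sym (cong (ℕ._* (k P′ s)) (ℕₚ.m≤n⇒m∸n≡0 (ℕ.s≤s⁻¹ (ℕₚ.≰⇒> s≮k)))))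

∑codes-linear : ∀ n {f g h : ℕ → ℕ} a → (∀ k → f k ≡ a ℕ.* g k ℕ.+ h k) →
                ∑codes n f ≡ a ℕ.* ∑codes n g ℕ.+ ∑codes n h
∑codes-linear n {f} {g} {h} a eq = go (codes n)
  where
  c : Fin (n ℕ.^ n) → ℕ
  c i = cycles (finToFun {n} {n} i)
  lem : ∀ a x y p q → (a ℕ.* x ℕ.+ y) ℕ.+ (a ℕ.* p ℕ.+ q) ≡ a ℕ.* (x ℕ.+ p) ℕ.+ (y ℕ.+ q)
  lem = solve 5 (λ a x y p q → (a :* x :+ y) :+ (a :* p :+ q) := a :* (x :+ p) :+ (y :+ q)) refl
    where open ℕ-Solver
  go : ∀ xs → sum (map (f ∘ c) xs) ≡ a ℕ.* sum (map (g ∘ c) xs) ℕ.+ sum (map (h ∘ c) xs)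
  go []       = sym (trans (ℕₚ.+-identityʳ _) (ℕₚ.*-zeroʳ a))
  go (x ∷ xs) = trans (cong₂ ℕ._+_ (eq (c x)) (go xs))
    (lem a (g (c x)) (h (c x)) (sum (map (g ∘ c) xs)) (sum (map (h ∘ c) xs)))

-- The integer n! βₛ(n), which lets the recurrence be proved without division.
moment : ℕ → ℕ → ℕ
moment s n = ∑codes n (_P s)

-- The factor n + 1 gathers the n fibres that keep the number of cycles and the summand (k)ₛ₊₁ of (k
-- + 1)ₛ₊₁ from the fibre that adds a fixed point.
moment-suc : ∀ s n → moment (suc s) (suc n) ≡ suc s ℕ.* moment s n ℕ.+ suc n ℕ.* moment (suc s) n
moment-suc s n = trans (∑codes-suc n (_P suc s))
  (trans (cong (ℕ._+ n ℕ.* moment (suc s) n)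
               (∑codes-linear n {g = _P s} {h = _P suc s} (suc s) (λ k → suc-P-suc k s)))
         (ℕₚ.+-assoc (suc s ℕ.* moment s n) _ _))

moment-zero : ∀ n → moment 0 n ≡ n !
moment-zero zero    = refl
moment-zero (suc n) = trans (∑codes-suc n (_P 0)) (cong (suc n ℕ.*_) (moment-zero n))

-- The moment β as an average over permutations

indicator : ℕ → ℕ → ℕ
indicator c k = if does (c ℕₚ.≟ k) then 1 else 0

indicator-≡ : ∀ c → indicator c c ≡ 1
indicator-≡ c = cong (λ b → if b then 1 else 0) (dec-true (c ℕₚ.≟ c) refl)

indicator-≢ : ∀ {c k} → c ≢ k → indicator c k ≡ 0
indicator-≢ {c} {k} c≢k = cong (λ b → if b then 1 else 0) (dec-false (c ℕₚ.≟ k) c≢k)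

-- Asymptotics of the factorial moments

module _ where

  open import Data.Rational.Base
  open import Data.Rational.Properties
  open import Data.Rational.Solver using (module +-*-Solver)
  open import Algebra.Definitions.RawSemiring +-*-rawSemiring using (_^_)
  open import Algebra.Properties.CommutativeSemiring.Exp
    (CommutativeRing.commutativeSemiring +-*-commutativeRing) using (^-distrib-*)

  ∑<-+ : ∀ n (f g : ℕ → ℚ) → ∑< n (λ i → f i + g i) ≡ ∑< n f + ∑< n g
  ∑<-+ zero    f g = refl
  ∑<-+ (suc n) f g = trans (cong (_+ (f n + g n)) (∑<-+ n f g)) (lem (∑< n f) (∑< n g) (f n) (g n))
    where
    open +-*-Solver
    lem : ∀ a b c d → (a + b) + (c + d) ≡ (a + c) + (b + d)
    lem = solve 4 (λ a b c d → (a :+ b) :+ (c :+ d) := (a :+ c) :+ (b :+ d)) refl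

  ∑<-indicator : ∀ N c (g : ℕ → ℚ) → c ℕ.< N → ∑< N (λ k → g k * fromℕ (indicator c k)) ≡ g c
  ∑<-indicator (suc N) c g c<1+N with c ℕₚ.≟ N
  ... | yes refl = trans (cong₂ _+_ (below c ℕₚ.≤-refl)
      (trans (cong (λ m → g c * fromℕ m) (indicator-≡ c)) (*-identityʳ (g c))))
    (+-identityˡ (g c))
    where
    below : ∀ M → M ℕ.≤ c → ∑< M (λ k → g k * fromℕ (indicator c k)) ≡ 0ℚ
    below zero    _   = refl
    below (suc M) M<c = cong₂ _+_ (below M (ℕₚ.<⇒≤ M<c))
      (trans (cong (λ m → g M * fromℕ m) (indicator-≢ (ℕₚ.<⇒≢ M<c ∘ sym))) (*-zeroʳ (g M)))
  ... | no c≢N = trans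
    (cong₂ _+_ (∑<-indicator N c g (ℕₚ.≤∧≢⇒< (ℕ.s≤s⁻¹ c<1+N) c≢N))
      (trans (cong (λ m → g N * fromℕ m) (indicator-≢ c≢N)) (*-zeroʳ (g N))))
    (+-identityʳ (g c))

  length-filter-∷ : ∀ {A : Set} (c : A → ℕ) k x xs →
    length (filter (λ y → c y ℕₚ.≟ k) (x ∷ xs)) ≡
    indicator (c x) k ℕ.+ length (filter (λ y → c y ℕₚ.≟ k) xs)
  length-filter-∷ c k x xs with does (c x ℕₚ.≟ k)
  ... | true  = refl
  ... | false = refl

  -- An exchange of summations: each `x` is counted for exactly one k, namely `c x`, and the bound
  -- by `N` ensures that this k is in range.
  ∑<-fibres : ∀ {A : Set} (c : A → ℕ) (g : ℕ → ℕ) N xs → (∀ x → c x ℕ.< N) →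
    ∑< N (λ k → fromℕ (g k) * fromℕ (length (filter (λ x → c x ℕₚ.≟ k) xs))) ≡ fromℕ (sum (map (g ∘ c) xs))
  ∑<-fibres c g N []       c<N = trans (∑<-cong N λ k → *-zeroʳ (fromℕ (g k)))
    (trans (∑<-const N 0ℚ) (*-zeroʳ (fromℕ N)))
  ∑<-fibres c g N (x ∷ xs) c<N = begin
    ∑< N (λ k → fromℕ (g k) * fromℕ (length (filter (λ y → c y ℕₚ.≟ k) (x ∷ xs))))
      ≡⟨ ∑<-cong N (λ k → trans
           (cong (fromℕ (g k) *_)
             (trans (cong fromℕ (length-filter-∷ c k x xs)) (fromℕ-+ (indicator (c x) k) _)))
           (*-distribˡ-+ (fromℕ (g k)) _ _)) ⟩
    ∑< N (λ k → fromℕ (g k) * fromℕ (indicator (c x) k) +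
                  fromℕ (g k) * fromℕ (length (filter (λ y → c y ℕₚ.≟ k) xs)))
      ≡⟨ ∑<-+ N _ _ ⟩
    ∑< N (λ k → fromℕ (g k) * fromℕ (indicator (c x) k)) + _
      ≡⟨ cong₂ _+_ (∑<-indicator N (c x) (fromℕ ∘ g) (c<N x)) (∑<-fibres c g N xs c<N) ⟩
    fromℕ (g (c x)) + fromℕ (sum (map (g ∘ c) xs))
      ≡⟨ fromℕ-+ (g (c x)) _ ⟨
    fromℕ (g (c x) ℕ.+ sum (map (g ∘ c) xs)) ∎
    where open ≡-Reasoning

  ∑<-*ʳ : ∀ n (f : ℕ → ℚ) w → ∑< n (λ i → f i * w) ≡ ∑< n f * w
  ∑<-*ʳ zero    f w = sym (*-zeroˡ w)
  ∑<-*ʳ (suc n) f w = trans (cong (_+ f n * w) (∑<-*ʳ n f w)) (sym (*-distribʳ-+ w (∑< n f) (f n)))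

  cycles≤n : ∀ {n} (σ : Fin n → Fin n) → cycles σ ℕ.≤ n
  cycles≤n {n} σ = ℕₚ.≤-trans (Listₚ.length-deduplicate (sameCycle? σ) (allFin n))
    (ℕₚ.≤-reflexive (Listₚ.length-tabulate {n = n} (λ i → i)))

  1/n! : ℕ → ℚ
  1/n! n = (+ 1 / n !) {{n ℕₚ.!≢0}}

  /≡* : ∀ a d .{{_ : ℕ.NonZero d}} → + a / d ≡ fromℕ a * (+ 1 / d)
  /≡* a (suc d) = /≡*u a d

  *1/≡1 : ∀ d .{{_ : ℕ.NonZero d}} → fromℕ d * (+ 1 / d) ≡ 1ℚ
  *1/≡1 (suc d) = fromℕ*u≡1 d

  n!*1/n! : ∀ n → fromℕ (n !) * 1/n! n ≡ 1ℚ
  n!*1/n! n = *1/≡1 (n !) {{n ℕₚ.!≢0}}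

  1/n!-suc : ∀ n → 1/n! (suc n) ≡ u n * 1/n! n
  1/n!-suc n = begin
    1/n! (suc n)
      ≡⟨ *-identityʳ _ ⟨
    1/n! (suc n) * 1ℚ
      ≡⟨ cong (1/n! (suc n) *_) (cong₂ _*_ (fromℕ*u≡1 n) (n!*1/n! n)) ⟨
    1/n! (suc n) * ((fromℕ (suc n) * u n) * (fromℕ (n !) * 1/n! n))
      ≡⟨ lem (1/n! (suc n)) (fromℕ (suc n)) (u n) (fromℕ (n !)) (1/n! n) ⟩
    ((fromℕ (suc n) * fromℕ (n !)) * 1/n! (suc n)) * (u n * 1/n! n)
      ≡⟨ cong (λ x → x * 1/n! (suc n) * (u n * 1/n! n)) (fromℕ-* (suc n) (n !)) ⟨
    (fromℕ (suc n !) * 1/n! (suc n)) * (u n * 1/n! n)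
      ≡⟨ cong (_* (u n * 1/n! n)) (n!*1/n! (suc n)) ⟩
    1ℚ * (u n * 1/n! n)
      ≡⟨ *-identityˡ _ ⟩
    u n * 1/n! n ∎
    where
    open ≡-Reasoning
    open +-*-Solver
    lem : ∀ a b c d e → a * ((b * c) * (d * e)) ≡ ((b * d) * a) * (c * e)
    lem = solve 5 (λ a b c d e → a :* ((b :* c) :* (d :* e)) := ((b :* d) :* a) :* (c :* e)) refl

  β≡moment : ∀ s n → β s n ≡ fromℕ (moment s n) * 1/n! n
  β≡moment s n = begin
    β s n
      ≡⟨ ∑<-cong (suc n) (λ k → trans
           (cong (fromℕ (k P s) *_) (/≡* C[ n , k ] (n !) {{n ℕₚ.!≢0}}))
           (sym (*-assoc (fromℕ (k P s)) (fromℕ C[ n , k ]) (1/n! n)))) ⟩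
    ∑< (suc n) (λ k → fromℕ (k P s) * fromℕ C[ n , k ] * 1/n! n)
      ≡⟨ ∑<-*ʳ (suc n) _ (1/n! n) ⟩
    ∑< (suc n) (λ k → fromℕ (k P s) * fromℕ C[ n , k ]) * 1/n! n
      ≡⟨ cong (_* 1/n! n) (∑<-fibres cycles (_P s) (suc n) (perms n) (ℕ.s≤s ∘ cycles≤n)) ⟩
    fromℕ (sum (map ((_P s) ∘ cycles) (perms n))) * 1/n! n
      ≡⟨ cong (λ m → fromℕ m * 1/n! n) (∑perms≡∑codes n (_P s)) ⟩
    fromℕ (moment s n) * 1/n! n ∎
    where open ≡-Reasoning

  β-zero : ∀ n → β 0 n ≡ 1ℚ
  β-zero n = trans (β≡moment 0 n)
    (trans (cong (λ m → fromℕ m * 1/n! n) (moment-zero n)) (n!*1/n! n))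

  β-suc-zero : ∀ s → β (suc s) 0 ≡ 0ℚ
  β-suc-zero s = trans (β≡moment (suc s) 0) (*-zeroˡ (1/n! 0))

  β-suc-suc : ∀ s n → β (suc s) (suc n) ≡ β (suc s) n + fromℕ (suc s) * u n * β s n
  β-suc-suc s n = begin
    β (suc s) (suc n)
      ≡⟨ β≡moment (suc s) (suc n) ⟩
    fromℕ (moment (suc s) (suc n)) * 1/n! (suc n)
      ≡⟨ cong₂ _*_ (trans (cong fromℕ (moment-suc s n))
           (trans (fromℕ-+ (suc s ℕ.* moment s n) _)
                  (cong₂ _+_ (fromℕ-* (suc s) (moment s n)) (fromℕ-* (suc n) (moment (suc s) n)))))
           (1/n!-suc n) ⟩
    (fromℕ (suc s) * m₀ + fromℕ (suc n) * m₁) * (u n * w)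
      ≡⟨ lem₁ (fromℕ (suc s)) m₀ (fromℕ (suc n)) m₁ (u n) w ⟩
    (fromℕ (suc n) * u n) * (m₁ * w) + fromℕ (suc s) * u n * (m₀ * w)
      ≡⟨ cong₂ (λ a b → a * b + fromℕ (suc s) * u n * (m₀ * w))
           (fromℕ*u≡1 n) (sym (β≡moment (suc s) n)) ⟩
    1ℚ * β (suc s) n + fromℕ (suc s) * u n * (m₀ * w)
      ≡⟨ cong₂ (λ a b → a + fromℕ (suc s) * u n * b) (*-identityˡ (β (suc s) n)) (sym (β≡moment s n)) ⟩
    β (suc s) n + fromℕ (suc s) * u n * β s n ∎
    where
    open ≡-Reasoning
    m₀ m₁ w : ℚ
    m₀ = fromℕ (moment s n)
    m₁ = fromℕ (moment (suc s) n)
    w  = 1/n! n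
    lem₁ : ∀ a x b y v w → (a * x + b * y) * (v * w) ≡ (b * v) * (y * w) + a * v * (x * w)
    lem₁ = solve 6 (λ a x b y v w → (a :* x :+ b :* y) :* (v :* w) :=
             (b :* v) :* (y :* w) :+ a :* v :* (x :* w)) refl
      where open +-*-Solver

  -- Order on the rationals and the sum of inverse squares

  0≤+ : ∀ {p q} → 0ℚ ≤ p → 0ℚ ≤ q → 0ℚ ≤ p + q
  0≤+ = +-mono-≤

  0≤* : ∀ {p q} → 0ℚ ≤ p → 0ℚ ≤ q → 0ℚ ≤ p * q
  0≤* {p} {q} 0≤p 0≤q = subst (_≤ p * q) (*-zeroʳ p) (*-monoˡ-≤-nonNeg p {{nonNegative 0≤p}} 0≤q)

  -- The form in which the inductive inequalities are proved: the solver checks an identity with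
  -- remainder `d`, and `d` is visibly nonnegative.
  q≡p+d⇒p≤q : ∀ {p q d} → q ≡ p + d → 0ℚ ≤ d → p ≤ q
  q≡p+d⇒p≤q refl = p≤p+q

  p≤q⇒0≤q-p : ∀ {p q} → p ≤ q → 0ℚ ≤ q - p
  p≤q⇒0≤q-p {p} {q} p≤q = subst (_≤ q - p) (+-inverseʳ p) (+-monoˡ-≤ (- p) p≤q)

  *-monoʳ : ∀ {p q r} → 0ℚ ≤ r → p ≤ q → p * r ≤ q * r
  *-monoʳ {r = r} 0≤r = *-monoʳ-≤-nonNeg r {{nonNegative 0≤r}}

  *-monoˡ : ∀ {p q r} → 0ℚ ≤ r → p ≤ q → r * p ≤ r * q
  *-monoˡ {r = r} 0≤r = *-monoˡ-≤-nonNeg r {{nonNegative 0≤r}}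

  0≤^ : ∀ {p} n → 0ℚ ≤ p → 0ℚ ≤ p ^ n
  0≤^ zero    0≤p = nonNegative⁻¹ 1ℚ
  0≤^ (suc n) 0≤p = 0≤* 0≤p (0≤^ n 0≤p)

  ^-mono-≤ : ∀ {p q} n → 0ℚ ≤ p → p ≤ q → p ^ n ≤ q ^ n
  ^-mono-≤ zero    0≤p p≤q = ≤-refl
  ^-mono-≤ (suc n) 0≤p p≤q =
    *-mono-≤ (≤-trans 0≤p p≤q) (0≤^ n 0≤p) p≤q (^-mono-≤ n 0≤p p≤q)

  0≤u : ∀ n → 0ℚ ≤ u n
  0≤u n = <⇒≤ (0<u n)

  0≤H : ∀ n → 0ℚ ≤ H n
  0≤H zero    = ≤-refl
  0≤H (suc n) = 0≤+ (0≤H n) (0≤u n)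

  fromℕ-suc : ∀ n → fromℕ (suc n) ≡ fromℕ n + 1ℚ
  fromℕ-suc n = trans (cong fromℕ (ℕₚ.+-comm 1 n)) (fromℕ-+ n 1)

  -- The partial fractions 1/((n + 1)(n + 2)) = 1/(n + 1) - 1/(n + 2), which make the next bound
  -- telescope.
  u-suc-+ : ∀ n → u (suc n) + u n * u (suc n) ≡ u n
  u-suc-+ n = begin
    x + y * x                              ≡⟨ cong (_+ y * x) (*-identityˡ x) ⟨
    1ℚ * x + y * x                         ≡⟨ cong (λ t → t * x + y * x) (fromℕ*u≡1 n) ⟨
    fromℕ (suc n) * y * x + y * x          ≡⟨ lem (fromℕ (suc n)) x y ⟩
    y * ((fromℕ (suc n) + 1ℚ) * x)         ≡⟨ cong (λ t → y * (t * x)) (fromℕ-suc (suc n)) ⟨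
    y * (fromℕ (suc (suc n)) * x)          ≡⟨ cong (y *_) (fromℕ*u≡1 (suc n)) ⟩
    y * 1ℚ                                 ≡⟨ *-identityʳ y ⟩
    y ∎
    where
    open ≡-Reasoning
    x y : ℚ
    x = u (suc n)
    y = u n
    lem : ∀ N x y → N * y * x + y * x ≡ y * ((N + 1ℚ) * x)
    lem = solve 3 (λ N x y → N :* y :* x :+ y :* x := y :* ((N :+ con 1ℚ) :* x)) refl
      where open +-*-Solver

  ∑u² : ℕ → ℚ
  ∑u² n = ∑< n λ i → u i * u i

  -- The added 1/(n + 1) makes the left side nonincreasing in n, because 1/(n + 2)² ≤ 1/((n + 1)(n +
  -- 2)); it starts at 1 + 1.
  ∑u²+u≤2 : ∀ n → ∑u² (suc n) + u n ≤ fromℕ 2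
  ∑u²+u≤2 zero    = ≤-refl
  ∑u²+u≤2 (suc n) = begin
    ∑u² (suc n) + x * x + x      ≡⟨ lem (∑u² (suc n)) x (x * x) ⟩
    ∑u² (suc n) + (x + x * x)    ≤⟨ +-monoʳ-≤ (∑u² (suc n)) (+-monoʳ-≤ x
                                      (*-monoʳ (0≤u (suc n)) (u-anti-≤ (ℕₚ.n≤1+n n)))) ⟩
    ∑u² (suc n) + (x + u n * x)  ≡⟨ cong (λ t → ∑u² (suc n) + t) (u-suc-+ n) ⟩
    ∑u² (suc n) + u n            ≤⟨ ∑u²+u≤2 n ⟩
    fromℕ 2                      ∎
    where
    open ≤-Reasoning
    x : ℚ
    x = u (suc n)
    lem : ∀ p x y → p + y + x ≡ p + (x + y)
    lem = solve 3 (λ p x y → p :+ y :+ x := p :+ (x :+ y)) refl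
      where open +-*-Solver

  ∑u²≤2 : ∀ n → ∑u² n ≤ fromℕ 2
  ∑u²≤2 zero    = 0≤fromℕ 2
  ∑u²≤2 (suc n) = ≤-trans (p≤p+q (0≤u n)) (∑u²+u≤2 n)

  -- The recurrence below is solved by b s n = s! eₛ(1, 1/2, …, 1/n).
  module Recurrence
    (b : ℕ → ℕ → ℚ)
    (b-zero : ∀ n → b 0 n ≡ 1ℚ)
    (b-suc-zero : ∀ s → b (suc s) 0 ≡ 0ℚ)
    (b-suc-suc : ∀ s n → b (suc s) (suc n) ≡ b (suc s) n + fromℕ (suc s) * u n * b s n)
    where

    0≤b : ∀ s n → 0ℚ ≤ b s n
    0≤b zero    n       = subst (0ℚ ≤_) (sym (b-zero n)) (nonNegative⁻¹ 1ℚ)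
    0≤b (suc s) zero    = ≤-reflexive (sym (b-suc-zero s))
    0≤b (suc s) (suc n) = subst (0ℚ ≤_) (sym (b-suc-suc s n))
      (0≤+ (0≤b (suc s) n) (0≤* (0≤* (0≤fromℕ (suc s)) (0≤u n)) (0≤b s n)))

    b-one : ∀ n → b 1 n ≡ H n
    b-one zero    = b-suc-zero 0
    b-one (suc n) = trans (b-suc-suc 0 n) (cong₂ _+_ (b-one n)
      (trans (cong (1ℚ * u n *_) (b-zero n)) (trans (*-identityʳ _) (*-identityˡ (u n)))))

    -- In terms of symmetric functions this is (s + 1) eₛ₊₁ ≤ e₁ eₛ: every product of s + 1 distinct
    -- reciprocals arises s + 1 times on the right.
    b-suc≤H*b : ∀ s n → b (suc s) n ≤ H n * b s n
    b-suc≤H*b zero n = ≤-reflexive (trans (b-one n)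
      (sym (trans (cong (H n *_) (b-zero n)) (*-identityʳ (H n)))))
    b-suc≤H*b (suc s) zero = ≤-reflexive (trans (b-suc-zero (suc s)) (sym (*-zeroˡ (b (suc s) 0))))
    b-suc≤H*b (suc s) (suc n) = q≡p+d⇒p≤q
      (begin
        (h + x) * b (suc s) (suc n)
          ≡⟨ cong ((h + x) *_) (b-suc-suc s n) ⟩
        (h + x) * (b₁ + a * x * b₀)
          ≡⟨ lem h x a b₀ b₁ b₂ ⟩
        b₂ + (a + 1ℚ) * x * b₁ + d
          ≡⟨ cong (λ t → b₂ + t * x * b₁ + d) (fromℕ-suc (suc s)) ⟨
        b₂ + fromℕ (suc (suc s)) * x * b₁ + d
          ≡⟨ cong (_+ d) (b-suc-suc (suc s) n) ⟨
        b (suc (suc s)) (suc n) + d ∎)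
      (0≤+ (0≤+ (p≤q⇒0≤q-p (b-suc≤H*b (suc s) n)) (0≤* 0≤ax (p≤q⇒0≤q-p (b-suc≤H*b s n))))
           (0≤* (0≤* 0≤ax (0≤u n)) (0≤b s n)))
      where
      open ≡-Reasoning
      h x a b₀ b₁ b₂ d : ℚ
      h = H n
      x = u n
      a = fromℕ (suc s)
      b₀ = b s n
      b₁ = b (suc s) n
      b₂ = b (suc (suc s)) n
      -- The instances (s + 1, n) and (s, n) of the inequality, plus a term from the repeated index
      -- n + 1.
      d = (h * b₁ - b₂) + a * x * (h * b₀ - b₁) + a * x * x * b₀
      0≤ax : 0ℚ ≤ a * x
      0≤ax = 0≤* (0≤fromℕ (suc s)) (0≤u n)
      lem : ∀ h x a b₀ b₁ b₂ → (h + x) * (b₁ + a * x * b₀) ≡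
            b₂ + (a + 1ℚ) * x * b₁ + ((h * b₁ - b₂) + a * x * (h * b₀ - b₁) + a * x * x * b₀)
      lem = solve 6 (λ h x a b₀ b₁ b₂ → (h :+ x) :* (b₁ :+ a :* x :* b₀) :=
        b₂ :+ (a :+ con 1ℚ) :* x :* b₁ :+
        ((h :* b₁ :- b₂) :+ a :* x :* (h :* b₀ :- b₁) :+ a :* x :* x :* b₀)) refl
        where open +-*-Solver

    H*b-suc≤ : ∀ s n → H n * b (suc s) n ≤ b (suc (suc s)) n + fromℕ (suc s) * ∑u² n * b s n
    H*b-suc≤ s zero = ≤-reflexive (trans (*-zeroˡ (b (suc s) 0))
      (sym (trans (cong (_+ fromℕ (suc s) * 0ℚ * b s 0) (b-suc-zero (suc s)))
           (trans (+-identityˡ _) (trans (cong (_* b s 0) (*-zeroʳ (fromℕ (suc s)))) (*-zeroˡ (b s 0)))))))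
    -- Separate because `b 0` is constant in n and does not follow the recurrence; here the instance
    -- (0, n) is the whole remainder.
    H*b-suc≤ zero (suc n) = q≡p+d⇒p≤q
      (begin
        b 2 (suc n) + 1ℚ * (p + x * x) * b 0 (suc n)
          ≡⟨ cong₂ (λ s t → s + 1ℚ * (p + x * x) * t) (b-suc-suc 1 n) (b-zero (suc n)) ⟩
        b₂ + fromℕ 2 * x * b 1 n + 1ℚ * (p + x * x) * 1ℚ
          ≡⟨ cong (λ t → b₂ + fromℕ 2 * x * t + 1ℚ * (p + x * x) * 1ℚ) (b-one n) ⟩
        b₂ + fromℕ 2 * x * h + 1ℚ * (p + x * x) * 1ℚ
          ≡⟨ lem h x p b₂ ⟩
        (h + x) * (h + x) + (b₂ + 1ℚ * p * 1ℚ - h * h)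
          ≡⟨ cong₂ (λ s t → (h + x) * s + t) (b-one (suc n))
               (cong₂ (λ s t → b₂ + 1ℚ * p * s - h * t) (b-zero n) (b-one n)) ⟨
        (h + x) * b 1 (suc n) + (b₂ + 1ℚ * p * b 0 n - h * b 1 n) ∎)
      (p≤q⇒0≤q-p (H*b-suc≤ zero n))
      where
      open ≡-Reasoning
      h x p b₂ : ℚ
      h = H n
      x = u n
      p = ∑u² n
      b₂ = b 2 n
      lem : ∀ h x p b₂ → b₂ + fromℕ 2 * x * h + 1ℚ * (p + x * x) * 1ℚ ≡
            (h + x) * (h + x) + (b₂ + 1ℚ * p * 1ℚ - h * h)
      lem = solve 4 (λ h x p b₂ → b₂ :+ con (fromℕ 2) :* x :* h :+ con 1ℚ :* (p :+ x :* x) :* con 1ℚ :=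
            (h :+ x) :* (h :+ x) :+ (b₂ :+ con 1ℚ :* p :* con 1ℚ :- h :* h)) refl
        where open +-*-Solver
    H*b-suc≤ (suc s) (suc n) = q≡p+d⇒p≤q
      (begin
        b (suc (suc (suc s))) (suc n) + fromℕ (suc (suc s)) * (p + x * x) * b (suc s) (suc n)
          ≡⟨ cong₂ (λ t v → t + fromℕ (suc (suc s)) * (p + x * x) * v)
               (b-suc-suc (suc (suc s)) n) (b-suc-suc s n) ⟩
        b₃ + fromℕ (suc (suc (suc s))) * x * b₂ + fromℕ (suc (suc s)) * (p + x * x) * (b₁ + a * x * b₀)
          ≡⟨ cong₂ (λ v w → b₃ + v * x * b₂ + w * (p + x * x) * (b₁ + a * x * b₀))
               (trans (fromℕ-suc (suc (suc s))) (cong (_+ 1ℚ) (fromℕ-suc (suc s)))) (fromℕ-suc (suc s)) ⟩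
        b₃ + (a + 1ℚ + 1ℚ) * x * b₂ + (a + 1ℚ) * (p + x * x) * (b₁ + a * x * b₀)
          ≡⟨ lem h x p a b₀ b₁ b₂ b₃ ⟩
        (h + x) * (b₂ + (a + 1ℚ) * x * b₁) + d (a + 1ℚ)
          ≡⟨ cong (λ t → (h + x) * (b₂ + t * x * b₁) + d t) (fromℕ-suc (suc s)) ⟨
        (h + x) * (b₂ + fromℕ (suc (suc s)) * x * b₁) + d (fromℕ (suc (suc s)))
          ≡⟨ cong (λ t → (h + x) * t + d (fromℕ (suc (suc s)))) (b-suc-suc (suc s) n) ⟨
        (h + x) * b (suc (suc s)) (suc n) + d (fromℕ (suc (suc s))) ∎)
      (0≤+ (0≤+ (p≤q⇒0≤q-p (H*b-suc≤ (suc s) n))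
                (0≤* (0≤* (0≤fromℕ (suc (suc s))) (0≤u n)) (p≤q⇒0≤q-p (H*b-suc≤ s n))))
           (0≤* (0≤* (0≤* (0≤fromℕ (suc (suc s))) (0≤fromℕ (suc s))) (0≤* (0≤* (0≤u n) (0≤u n)) (0≤u n)))
                (0≤b s n)))
      where
      open ≡-Reasoning
      h x p a b₀ b₁ b₂ b₃ : ℚ
      h = H n
      x = u n
      p = ∑u² n
      a = fromℕ (suc s)
      b₀ = b s n
      b₁ = b (suc s) n
      b₂ = b (suc (suc s)) n
      b₃ = b (suc (suc (suc s))) n
      d : ℚ → ℚ
      -- Again the instances (s + 1, n) and (s, n), with a cubic leftover. The argument `a′` is s +
      -- 2 in two guises: `a + 1ℚ` for the solver, and the numeral that the recurrence produces.
      d a′ = (b₃ + a′ * p * b₁ - h * b₂) + a′ * x * (b₂ + a * p * b₀ - h * b₁) + a′ * a * (x * x * x) * b₀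
      lem : ∀ h x p a b₀ b₁ b₂ b₃ →
        b₃ + (a + 1ℚ + 1ℚ) * x * b₂ + (a + 1ℚ) * (p + x * x) * (b₁ + a * x * b₀) ≡
        (h + x) * (b₂ + (a + 1ℚ) * x * b₁) +
        ((b₃ + (a + 1ℚ) * p * b₁ - h * b₂) + (a + 1ℚ) * x * (b₂ + a * p * b₀ - h * b₁) +
         (a + 1ℚ) * a * (x * x * x) * b₀)
      lem = solve 8 (λ h x p a b₀ b₁ b₂ b₃ →
        b₃ :+ (a :+ con 1ℚ :+ con 1ℚ) :* x :* b₂ :+ (a :+ con 1ℚ) :* (p :+ x :* x) :* (b₁ :+ a :* x :* b₀) :=
        (h :+ x) :* (b₂ :+ (a :+ con 1ℚ) :* x :* b₁) :+
        ((b₃ :+ (a :+ con 1ℚ) :* p :* b₁ :- h :* b₂) :+ (a :+ con 1ℚ) :* x :* (b₂ :+ a :* p :* b₀ :- h :* b₁) :+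
         (a :+ con 1ℚ) :* a :* (x :* x :* x) :* b₀)) refl
        where open +-*-Solver

    b≤H^ : ∀ s n → b s n ≤ H n ^ s
    b≤H^ zero    n = ≤-reflexive (b-zero n)
    b≤H^ (suc s) n = ≤-trans (b-suc≤H*b s n) (*-monoˡ (0≤H n) (b≤H^ s n))

    -- In closed form (s + 1)(s + 2). Each further factor Hₙ costs (s + 2) · 2, the 2 being the
    -- bound on the sum of inverse squares.
    H-binomialConst : ℕ → ℚ
    H-binomialConst zero    = fromℕ 2
    H-binomialConst (suc s) = H-binomialConst s + fromℕ (suc (suc s)) * fromℕ 2

    0≤H-binomialConst : ∀ s → 0ℚ ≤ H-binomialConst s
    0≤H-binomialConst zero    = 0≤fromℕ 2
    0≤H-binomialConst (suc s) = 0≤+ (0≤H-binomialConst s) (0≤* (0≤fromℕ (suc (suc s))) (0≤fromℕ 2))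

    H^≤b+ : ∀ s n → H n ^ suc (suc s) ≤ b (suc (suc s)) n + H-binomialConst s * H n ^ s
    H^≤b+ zero n = begin
      h * (h * 1ℚ)               ≡⟨ cong (h *_) (trans (*-identityʳ h) (sym (b-one n))) ⟩
      h * b 1 n                  ≤⟨ H*b-suc≤ 0 n ⟩
      b 2 n + 1ℚ * ∑u² n * b 0 n ≡⟨ cong₂ (λ s t → b 2 n + s * t) (*-identityˡ (∑u² n)) (b-zero n) ⟩
      b 2 n + ∑u² n * 1ℚ         ≤⟨ +-monoʳ-≤ (b 2 n) (*-monoʳ (nonNegative⁻¹ 1ℚ) (∑u²≤2 n)) ⟩
      b 2 n + fromℕ 2 * 1ℚ       ∎
      where
      open ≤-Reasoning
      h = H n
    H^≤b+ (suc s) n = begin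
      h * h ^ suc (suc s)
        ≤⟨ *-monoˡ (0≤H n) (H^≤b+ s n) ⟩
      h * (b₂ + c * h ^ s)
        ≡⟨ lem₁ h b₂ c (h ^ s) ⟩
      h * b₂ + c * h ^ suc s
        ≤⟨ +-monoˡ-≤ (c * h ^ suc s) (≤-trans (H*b-suc≤ (suc s) n)
             (+-monoʳ-≤ b₃ (*-mono-≤ (0≤* 0≤a (0≤fromℕ 2)) (0≤b (suc s) n)
               (*-monoˡ 0≤a (∑u²≤2 n)) (b≤H^ (suc s) n)))) ⟩
      b₃ + a * fromℕ 2 * h ^ suc s + c * h ^ suc s
        ≡⟨ lem₂ b₃ (a * fromℕ 2) c (h ^ suc s) ⟩
      b₃ + (c + a * fromℕ 2) * h ^ suc s ∎
      where
      open ≤-Reasoning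
      h c a b₂ b₃ : ℚ
      h = H n
      c = H-binomialConst s
      a = fromℕ (suc (suc s))
      b₂ = b (suc (suc s)) n
      b₃ = b (suc (suc (suc s))) n
      0≤a : 0ℚ ≤ a
      0≤a = 0≤fromℕ (suc (suc s))
      lem₁ : ∀ h b c y → h * (b + c * y) ≡ h * b + c * (h * y)
      lem₁ = solve 4 (λ h b c y → h :* (b :+ c :* y) := h :* b :+ c :* (h :* y)) refl
        where open +-*-Solver
      lem₂ : ∀ b p c y → b + p * y + c * y ≡ b + (c + p) * y
      lem₂ = solve 4 (λ b p c y → b :+ p :* y :+ c :* y := b :+ (c :+ p) :* y) refl
        where open +-*-Solver

  -- First-order expansion of a power of L + r

  module BinomialLower {L r : ℚ} (0≤L : 0ℚ ≤ L) (0≤r : 0ℚ ≤ r) where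

    bernoulli : ∀ m → L ^ suc m + fromℕ (suc m) * r * L ^ m ≤ (L + r) ^ suc m
    bernoulli zero    = ≤-reflexive (lem L r)
      where
      lem : ∀ L r → L * 1ℚ + 1ℚ * r * 1ℚ ≡ (L + r) * 1ℚ
      lem = solve 2 (λ L r → L :* con 1ℚ :+ con 1ℚ :* r :* con 1ℚ := (L :+ r) :* con 1ℚ) refl
        where open +-*-Solver
    bernoulli (suc m) = ≤-trans
      (q≡p+d⇒p≤q
        (trans (lem L r a (L ^ m))
               (cong (λ t → L * (L * L ^ m) + t * r * (L * L ^ m) + d) (sym (fromℕ-suc (suc m)))))
        (0≤* (0≤* (0≤fromℕ (suc m)) (0≤* 0≤r 0≤r)) (0≤^ m 0≤L)))
      (*-monoˡ (0≤+ 0≤L 0≤r) (bernoulli m))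
      where
      a d : ℚ
      a = fromℕ (suc m)
      d = a * (r * r) * L ^ m
      lem : ∀ L r a y → (L + r) * (L * y + a * r * y) ≡ L * (L * y) + (a + 1ℚ) * r * (L * y) + a * (r * r) * y
      lem = solve 4 (λ L r a y → (L :+ r) :* (L :* y :+ a :* r :* y) :=
              L :* (L :* y) :+ (a :+ con 1ℚ) :* r :* (L :* y) :+ a :* (r :* r) :* y) refl
        where open +-*-Solver

  -- Bounds, in units of Lᵐ, the terms of (L + r)ᵐ⁺² of degree at least two in r. Another factor L +
  -- r at most doubles them, as L + r ≤ 2L, and the linear term contributes (m + 2) r² ≤ m + 2.
  binomialConst : ℕ → ℚ
  binomialConst zero    = 1ℚ
  binomialConst (suc m) = fromℕ 2 * binomialConst m + fromℕ (suc (suc m))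

  0≤binomialConst : ∀ m → 0ℚ ≤ binomialConst m
  0≤binomialConst zero    = nonNegative⁻¹ 1ℚ
  0≤binomialConst (suc m) = 0≤+ (0≤* (0≤fromℕ 2) (0≤binomialConst m)) (0≤fromℕ (suc (suc m)))

  module BinomialUpper {L r : ℚ} (1≤L : 1ℚ ≤ L) (0≤r : 0ℚ ≤ r) (r≤1 : r ≤ 1ℚ) where

    0≤L : 0ℚ ≤ L
    0≤L = ≤-trans (nonNegative⁻¹ 1ℚ) 1≤L

    r²≤1 : r * r ≤ 1ℚ
    r²≤1 = *-mono-≤ (nonNegative⁻¹ 1ℚ) 0≤r r≤1 r≤1

    L+r≤2L : L + r ≤ fromℕ 2 * L
    L+r≤2L = subst (L + r ≤_) (lem L) (+-monoʳ-≤ L (≤-trans r≤1 1≤L))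
      where
      lem : ∀ L → L + L ≡ fromℕ 2 * L
      lem = solve 1 (λ L → L :+ L := con (fromℕ 2) :* L) refl
        where open +-*-Solver

    binomial-≤ : ∀ m → (L + r) ^ suc (suc m) ≤
      L ^ suc (suc m) + fromℕ (suc (suc m)) * r * L ^ suc m + binomialConst m * L ^ m
    binomial-≤ zero    = begin
      (L + r) * ((L + r) * 1ℚ)                                ≡⟨ lem L r ⟩
      L * (L * 1ℚ) + fromℕ 2 * r * (L * 1ℚ) + r * r           ≤⟨ +-monoʳ-≤ (L * (L * 1ℚ) + fromℕ 2 * r * (L * 1ℚ)) r²≤1 ⟩
      L * (L * 1ℚ) + fromℕ 2 * r * (L * 1ℚ) + 1ℚ              ∎
      where
      open ≤-Reasoning
      lem : ∀ L r → (L + r) * ((L + r) * 1ℚ) ≡ L * (L * 1ℚ) + fromℕ 2 * r * (L * 1ℚ) + r * r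
      lem = solve 2 (λ L r → (L :+ r) :* ((L :+ r) :* con 1ℚ) :=
              L :* (L :* con 1ℚ) :+ con (fromℕ 2) :* r :* (L :* con 1ℚ) :+ r :* r) refl
        where open +-*-Solver
    binomial-≤ (suc m) = begin
      (L + r) * (L + r) ^ suc (suc m)
        ≤⟨ *-monoˡ (0≤+ 0≤L 0≤r) (binomial-≤ m) ⟩
      (L + r) * (L * (L * y) + a * r * (L * y) + e * y)
        ≡⟨ lem L r a e y ⟩
      L * (L * (L * y)) + (a + 1ℚ) * r * (L * (L * y)) + ((L + r) * (e * y) + a * (r * r) * (L * y))
        ≤⟨ +-monoʳ-≤ (L * (L * (L * y)) + (a + 1ℚ) * r * (L * (L * y)))
             (+-mono-≤ (*-monoʳ (0≤* (0≤binomialConst m) (0≤^ m 0≤L)) L+r≤2L)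
             (*-monoʳ (0≤^ (suc m) 0≤L) (*-monoˡ (0≤fromℕ (suc (suc m))) r²≤1))) ⟩
      L * (L * (L * y)) + (a + 1ℚ) * r * (L * (L * y)) + (fromℕ 2 * L * (e * y) + a * 1ℚ * (L * y))
        ≡⟨ cong₂ _+_ (cong (λ t → L * (L * (L * y)) + t * r * (L * (L * y))) (sym (fromℕ-suc (suc (suc m)))))
             (lem₂ L a e y) ⟩
      L * (L * (L * y)) + fromℕ (suc (suc (suc m))) * r * (L * (L * y)) + (fromℕ 2 * e + a) * (L * y) ∎
      where
      open ≤-Reasoning
      a e y : ℚ
      a = fromℕ (suc (suc m))
      e = binomialConst m
      y = L ^ m
      lem : ∀ L r a e y → (L + r) * (L * (L * y) + a * r * (L * y) + e * y) ≡
        L * (L * (L * y)) + (a + 1ℚ) * r * (L * (L * y)) + ((L + r) * (e * y) + a * (r * r) * (L * y))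
      lem = solve 5 (λ L r a e y → (L :+ r) :* (L :* (L :* y) :+ a :* r :* (L :* y) :+ e :* y) :=
        L :* (L :* (L :* y)) :+ (a :+ con 1ℚ) :* r :* (L :* (L :* y)) :+
        ((L :+ r) :* (e :* y) :+ a :* (r :* r) :* (L :* y))) refl
        where open +-*-Solver
      lem₂ : ∀ L a e y → fromℕ 2 * L * (e * y) + a * 1ℚ * (L * y) ≡ (fromℕ 2 * e + a) * (L * y)
      lem₂ = solve 4 (λ L a e y → con (fromℕ 2) :* L :* (e :* y) :+ a :* con 1ℚ :* (L :* y) :=
        (con (fromℕ 2) :* e :+ a) :* (L :* y)) refl
        where open +-*-Solver

  open Recurrence β β-zero β-suc-zero β-suc-suc

  -- In order: the tail of the binomial expansion; the gap between β and the power of Hₙ, converted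
  -- by Hₙ ≤ 2L; the replacement of r by `g`. Each direction of the estimate pads with the summand
  -- it lacks, so that one constant serves both.
  errorConst : ℕ → ℚ
  errorConst m = binomialConst m + H-binomialConst m * fromℕ 2 ^ m + fromℕ (suc (suc m)) * fromℕ 4

  ≤+∣p-q∣ : ∀ {p q δ} → ∣ p - q ∣ ≤ δ → p ≤ q + δ
  ≤+∣p-q∣ {p} {q} {δ} h = subst (_≤ q + δ) (lem p q) (+-monoʳ-≤ q (≤-trans (p≤∣p∣ (p - q)) h))
    where
    lem : ∀ p q → q + (p - q) ≡ p
    lem = solve 2 (λ p q → q :+ (p :- q) := p) refl
      where open +-*-Solver

  -- L and g stand for rational approximations of log n and of γ.
  module Estimate (n : ℕ) {L g δ : ℚ} (1≤L : 1ℚ ≤ L) (L≤H : L ≤ H n) (H≤L+1 : H n ≤ L + 1ℚ)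
    (close : ∣ g - (H n - L) ∣ ≤ δ) (δL≤4 : δ * L ≤ fromℕ 4) where

    r : ℚ
    r = H n - L

    L+r≡H : L + r ≡ H n
    L+r≡H = lem L (H n)
      where
      lem : ∀ L h → L + (h - L) ≡ h
      lem = solve 2 (λ L h → L :+ (h :- L) := h) refl
        where open +-*-Solver

    0≤r : 0ℚ ≤ r
    0≤r = p≤q⇒0≤q-p L≤H

    r≤1 : r ≤ 1ℚ
    r≤1 = p≤q+r⇒p-q≤r (H n) L H≤L+1

    open BinomialUpper 1≤L 0≤r r≤1
    open BinomialLower 0≤L 0≤r

    g≤r+δ : g ≤ r + δ
    g≤r+δ = ≤+∣p-q∣ close

    r≤g+δ : r ≤ g + δ
    r≤g+δ = ≤+∣p-q∣ (subst (_≤ δ) (∣p-q∣≡∣q-p∣ g r) close)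

    -- The factors `1ℚ` match the unfolding of the real powers, so that this is the k-th approximant
    -- of the real inequality as it stands.
    estimate-one : ∣ β 1 n - (L * 1ℚ + g * fromℕ 1 * 1ℚ) ∣ ≤ fromℕ 4 * (recip L * 1ℚ)
    estimate-one = begin
      ∣ β 1 n - (L * 1ℚ + g * 1ℚ * 1ℚ) ∣
        ≡⟨ cong ∣_∣ (trans (cong (_- (L * 1ℚ + g * 1ℚ * 1ℚ)) (b-one n)) (lem (H n) L g)) ⟩
      ∣ r - g ∣
        ≡⟨ ∣p-q∣≡∣q-p∣ r g ⟩
      ∣ g - r ∣
        ≤⟨ close ⟩
      δ
        ≡⟨ trans (cong (δ *_) (*-recip 0<L)) (*-identityʳ δ) ⟨
      δ * (L * recip L)
        ≡⟨ *-assoc δ L (recip L) ⟨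
      δ * L * recip L
        ≤⟨ *-monoʳ (<⇒≤ (0<recip 0<L)) δL≤4 ⟩
      fromℕ 4 * recip L
        ≡⟨ cong (fromℕ 4 *_) (*-identityʳ (recip L)) ⟨
      fromℕ 4 * (recip L * 1ℚ) ∎
      where
      open ≤-Reasoning
      0<L : 0ℚ < L
      0<L = <-≤-trans (positive⁻¹ 1ℚ) 1≤L
      lem : ∀ h L g → h - (L * 1ℚ + g * 1ℚ * 1ℚ) ≡ (h - L) - g
      lem = solve 3 (λ h L g → h :- (L :* con 1ℚ :+ g :* con 1ℚ :* con 1ℚ) := (h :- L) :- g) refl
        where open +-*-Solver

    module _ (m : ℕ) where

      a y : ℚ
      a = fromℕ (suc (suc m))
      y = L ^ m

      0≤y : 0ℚ ≤ y
      0≤y = 0≤^ m 0≤L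

      -- δ L ≤ 4 trades one power of L for a constant.
      absorb : ∀ {p q} → p ≤ q + δ → p * a * (L * y) ≤ a * q * (L * y) + a * fromℕ 4 * y
      absorb {p} {q} p≤q+δ = begin
        p * a * (L * y)
          ≤⟨ *-monoʳ (0≤* 0≤L 0≤y) (*-monoʳ (0≤fromℕ (suc (suc m))) p≤q+δ) ⟩
        (q + δ) * a * (L * y)
          ≡⟨ lem q δ a L y ⟩
        a * q * (L * y) + a * (δ * L) * y
          ≤⟨ +-monoʳ-≤ (a * q * (L * y)) (*-monoʳ 0≤y (*-monoˡ (0≤fromℕ (suc (suc m))) δL≤4)) ⟩
        a * q * (L * y) + a * fromℕ 4 * y ∎
        where
        open ≤-Reasoning
        lem : ∀ q δ a L y → (q + δ) * a * (L * y) ≡ a * q * (L * y) + a * (δ * L) * y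
        lem = solve 5 (λ q δ a L y → (q :+ δ) :* a :* (L :* y) := a :* q :* (L :* y) :+ a :* (δ :* L) :* y) refl
          where open +-*-Solver

      H^≤ : H n ^ m ≤ fromℕ 2 ^ m * y
      H^≤ = subst₂ _≤_ (cong (_^ m) L+r≡H) (^-distrib-* (fromℕ 2) L m)
        (^-mono-≤ m (0≤+ 0≤L 0≤r) L+r≤2L)

      main : ℚ
      main = L ^ suc (suc m) + g * a * L ^ suc m

      β≤ : β (suc (suc m)) n ≤ main + errorConst m * y
      β≤ = begin
        β (suc (suc m)) n
          ≤⟨ b≤H^ (suc (suc m)) n ⟩
        H n ^ suc (suc m)
          ≡⟨ cong (_^ suc (suc m)) L+r≡H ⟨
        (L + r) ^ suc (suc m)
          ≤⟨ binomial-≤ m ⟩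
        x + a * r * (L * y) + binomialConst m * y
          ≡⟨ cong (λ t → x + t * (L * y) + binomialConst m * y) (*-comm a r) ⟩
        x + r * a * (L * y) + binomialConst m * y
          ≤⟨ +-monoˡ-≤ (binomialConst m * y) (+-monoʳ-≤ x (absorb r≤g+δ)) ⟩
        x + (a * g * (L * y) + a * fromℕ 4 * y) + binomialConst m * y
          ≤⟨ p≤p+q (0≤* (0≤* (0≤H-binomialConst m) (0≤^ m (0≤fromℕ 2))) 0≤y) ⟩
        x + (a * g * (L * y) + a * fromℕ 4 * y) + binomialConst m * y + H-binomialConst m * fromℕ 2 ^ m * y
          ≡⟨ lem x a g (L * y) y (binomialConst m) (H-binomialConst m * fromℕ 2 ^ m) (a * fromℕ 4) ⟩
        main + errorConst m * y ∎
        where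
        open ≤-Reasoning
        x : ℚ
        x = L ^ suc (suc m)
        lem : ∀ x a g z y e c f → x + (a * g * z + f * y) + e * y + c * y ≡ x + g * a * z + (e + c + f) * y
        lem = solve 8 (λ x a g z y e c f → x :+ (a :* g :* z :+ f :* y) :+ e :* y :+ c :* y :=
                x :+ g :* a :* z :+ (e :+ c :+ f) :* y) refl
          where open +-*-Solver

      ≤β : main ≤ β (suc (suc m)) n + errorConst m * y
      ≤β = begin
        x + g * a * (L * y)
          ≤⟨ +-monoʳ-≤ x (absorb g≤r+δ) ⟩
        x + (a * r * (L * y) + a * fromℕ 4 * y)
          ≡⟨ +-assoc x _ _ ⟨
        x + a * r * (L * y) + a * fromℕ 4 * y
          ≤⟨ +-monoˡ-≤ (a * fromℕ 4 * y) (bernoulli (suc m)) ⟩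
        (L + r) ^ suc (suc m) + a * fromℕ 4 * y
          ≡⟨ cong (λ t → t ^ suc (suc m) + a * fromℕ 4 * y) L+r≡H ⟩
        H n ^ suc (suc m) + a * fromℕ 4 * y
          ≤⟨ +-monoˡ-≤ (a * fromℕ 4 * y) (H^≤b+ m n) ⟩
        b + H-binomialConst m * H n ^ m + a * fromℕ 4 * y
          ≤⟨ +-monoˡ-≤ (a * fromℕ 4 * y) (+-monoʳ-≤ b (*-monoˡ (0≤H-binomialConst m) H^≤)) ⟩
        b + H-binomialConst m * (fromℕ 2 ^ m * y) + a * fromℕ 4 * y
          ≤⟨ p≤p+q (0≤* (0≤binomialConst m) 0≤y) ⟩
        b + H-binomialConst m * (fromℕ 2 ^ m * y) + a * fromℕ 4 * y + binomialConst m * y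
          ≡⟨ lem b (H-binomialConst m) (fromℕ 2 ^ m) y (a * fromℕ 4) (binomialConst m) ⟩
        b + errorConst m * y ∎
        where
        open ≤-Reasoning
        x b : ℚ
        x = L ^ suc (suc m)
        b = β (suc (suc m)) n
        lem : ∀ b c t y f e → b + c * (t * y) + f * y + e * y ≡ b + (e + c * t + f) * y
        lem = solve 6 (λ b c t y f e → b :+ c :* (t :* y) :+ f :* y :+ e :* y :=
                b :+ (e :+ c :* t :+ f) :* y) refl
          where open +-*-Solver

      estimate : ∣ β (suc (suc m)) n - main ∣ ≤ errorConst m * y
      estimate = ∣p-q∣≤ (β (suc (suc m)) n) main
        (p≤q+r⇒p-q≤r (β (suc (suc m)) n) main β≤) (p≤q+r⇒p-q≤r main (β (suc (suc m)) n) ≤β)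

  -- Rational approximants of log n and γ against Hₙ

  0≤∑< : ∀ n {f} → (∀ i → 0ℚ ≤ f i) → 0ℚ ≤ ∑< n f
  0≤∑< zero    0≤f = ≤-refl
  0≤∑< (suc n) 0≤f = 0≤+ (0≤∑< n 0≤f) (0≤f n)

  -- The Riemann sum of mesh 1 is the harmonic sum without its first term; refining the mesh then
  -- places the approximants of log n between Hₙ - 1 and Hₙ.
  H-suc : ∀ l → H (suc l) ≡ S l 1 + 1ℚ
  H-suc l = trans (∑<-split 1 l u) (trans (+-comm (0ℚ + u 0) (∑< l (λ i → u (1 ℕ.+ i))))
    (cong (_+ 1ℚ) (cong (λ k → ∑< k (λ i → u (1 ℕ.+ i))) (sym (ℕₚ.*-identityʳ l)))))

  S≤H : ∀ l k → S l (suc k) ≤ H (suc l)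
  S≤H l k = subst₂ (λ p h → S l p ≤ h) (ℕₚ.*-identityˡ (suc k)) (sym (H-suc l)) (S-refine-≤ l 0 k)

  S1≤S : ∀ l k → S l 1 ≤ S l (suc k)
  S1≤S l k = subst (λ p → S l 1 ≤ S l p) (ℕₚ.*-identityˡ (suc k)) (S-refine-≥ l 1 k)

  H≤S+1 : ∀ l k → H (suc l) ≤ S l (suc k) + 1ℚ
  H≤S+1 l k = subst (_≤ S l (suc k) + 1ℚ) (sym (H-suc l)) (+-monoˡ-≤ 1ℚ (S1≤S l k))

  -- Three terms suffice, since 1/2 + 1/3 + 1/4 = 13/12. This is the origin of the threshold n ≥ 4.
  1≤S : ∀ {l} k → 3 ℕ.≤ l → 1ℚ ≤ S l (suc k)
  1≤S {l} k 3≤l = ≤-trans (≤-trans 1≤S31 S31≤) (S1≤S l k)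
    where
    f : ℕ → ℚ
    f i = u (1 ℕ.+ i)
    1≤S31 : 1ℚ ≤ ∑< 3 f
    1≤S31 = ≤ᵇ⇒≤ _
    S31≤ : ∑< 3 f ≤ S l 1
    S31≤ = subst (∑< 3 f ≤_)
      (trans (sym (∑<-split 3 (l ℕ.∸ 3) f))
             (cong (λ k → ∑< k f) (trans (ℕₚ.m+[n∸m]≡n 3≤l) (sym (ℕₚ.*-identityʳ l)))))
      (p≤p+q (0≤∑< (l ℕ.∸ 3) (λ i → 0≤u (1 ℕ.+ (3 ℕ.+ i)))))

  u≤1 : ∀ n → u n ≤ 1ℚ
  u≤1 n = u-anti-≤ {0} {n} ℕ.z≤n

  H≤fromℕ : ∀ n → H n ≤ fromℕ n
  H≤fromℕ n = subst (H n ≤_) (trans (∑<-const n 1ℚ) (*-identityʳ (fromℕ n)))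
    (∑<-mono n (λ i _ → u≤1 i))

  -- The explicit numeral 1 / (l + 1) lets the modulus of H-log-cauchy compute to l.
  H-log-close : ∀ l m k j → l ℕ.≤ m → l ℕ.≤ k →
    ∣ seq (H-log m) j - seq (H-log k) j ∣ ≤ u l + u l
  H-log-close l m k j l≤m l≤k =
    subst (λ ε → ∣ seq (H-log m) j - seq (H-log k) j ∣ ≤ ε + u l) u≡
      (proj₂ (H-log-cauchy v 0<v) m k l≤m l≤k (u l) (0<u l) .proj₂ j ℕ.z≤n)
    where
    v : ℚ
    v = mkℚ (+ 1) l (1-coprimeTo (suc l))
    u≡ : v ≡ u l
    u≡ = sym (normalize-coprime (1-coprimeTo (suc l)))
    0<v : 0ℚ < v
    0<v = subst (0ℚ <_) (sym u≡) (0<u l)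

  -- The four units of 1/(l + 1): one for the approximant that defines `seq γ k`, two for passing
  -- from `H-log k` to `H-log l`, one for the change of mesh.
  γ-close : ∀ l k → l ℕ.≤ k → ∣ seq γ k - (H (suc l) - S l (suc k)) ∣ ≤ fromℕ 4 * u l
  γ-close l k l≤k = begin
    ∣ seq γ k - (H (suc l) - S l (suc k)) ∣
      ≤⟨ ∣p-r∣≤∣p-q∣+∣q-r∣ (seq γ k) (seq (H-log k) j) _ ⟩
    ∣ seq γ k - seq (H-log k) j ∣ + ∣ seq (H-log k) j - (H (suc l) - S l (suc k)) ∣
      ≤⟨ +-mono-≤ γ-limit (∣p-r∣≤∣p-q∣+∣q-r∣ (seq (H-log k) j) (seq (H-log l) j) _) ⟩
    u l + (∣ seq (H-log k) j - seq (H-log l) j ∣ + ∣ seq (H-log l) j - (H (suc l) - S l (suc k)) ∣)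
      ≤⟨ +-monoʳ-≤ (u l) (+-mono-≤ (H-log-close l k l j l≤k ℕₚ.≤-refl) S-limit) ⟩
    u l + (u l + u l + u l)
      ≡⟨ lem (u l) ⟩
    fromℕ 4 * u l ∎
    where
    open ≤-Reasoning
    M : ℕ
    M = proj₁ (cauchy (H-log k) (u k) (0<u k))
    -- Past the modulus that defines `seq γ k`, and fine enough for a mesh of at most 1/(l + 1).
    j : ℕ
    j = M ℕ.⊔ k
    γ-limit : ∣ seq γ k - seq (H-log k) j ∣ ≤ u l
    γ-limit = ≤-trans
      (proj₂ (cauchy (H-log k) (u k) (0<u k)) M j ℕₚ.≤-refl (ℕₚ.m≤m⊔n M k)) (u-anti-≤ l≤k)
    sub-cancel : ∀ h a b → (h - a) - (h - b) ≡ b - a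
    sub-cancel = solve 3 (λ h a b → (h :- a) :- (h :- b) := b :- a) refl
      where open +-*-Solver
    S-limit : ∣ seq (H-log l) j - (H (suc l) - S l (suc k)) ∣ ≤ u l
    S-limit = subst (λ t → ∣ t ∣ ≤ u l)
      (sym (trans (cong (λ s → (H (suc l) - s) - (H (suc l) - S l (suc k))) (riemann≡S l j))
                  (sub-cancel (H (suc l)) (S l (suc j)) (S l (suc k)))))
      (∣p-q∣≤ (S l (suc k)) (S l (suc j))
        (≤-trans (S-close l k j) (u-anti-≤ (ℕₚ.≤-trans l≤k (ℕₚ.m≤n⊔m M k))))
        (≤-trans (S-close l j k) (u-anti-≤ l≤k)))
    lem : ∀ x → x + (x + x + x) ≡ fromℕ 4 * x
    lem = solve 1 (λ x → x :+ (x :+ x :+ x) := con (fromℕ 4) :* x) refl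
      where open +-*-Solver

  seq-^ℝ : ∀ x n k → seq (x ^ℝ n) k ≡ seq x k ^ n
  seq-^ℝ x zero    k = refl
  seq-^ℝ x (suc n) k = cong (seq x k *_) (seq-^ℝ x n k)


  module LogEstimate {l k : ℕ} (3≤l : 3 ℕ.≤ l) (l≤k : l ℕ.≤ k) where

    private
      L : ℚ
      L = seq (log (suc l)) k

      S≡L : S l (suc k) ≡ L
      S≡L = sym (riemann≡S l k)

      L≤H : L ≤ H (suc l)
      L≤H = subst (_≤ H (suc l)) S≡L (S≤H l k)

      -- The crude L ≤ Hₙ ≤ n with n = l + 1 is enough to cancel the 1/n.
      4uL≤4 : fromℕ 4 * u l * L ≤ fromℕ 4
      4uL≤4 = begin
        fromℕ 4 * u l * L                  ≤⟨ *-monoˡ (0≤* (0≤fromℕ 4) (0≤u l)) (≤-trans L≤H (H≤fromℕ (suc l))) ⟩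
        fromℕ 4 * u l * fromℕ (suc l)      ≡⟨ *-assoc (fromℕ 4) (u l) (fromℕ (suc l)) ⟩
        fromℕ 4 * (u l * fromℕ (suc l))    ≡⟨ cong (fromℕ 4 *_) (trans (*-comm (u l) (fromℕ (suc l))) (fromℕ*u≡1 l)) ⟩
        fromℕ 4                            ∎
        where open ≤-Reasoning

    open Estimate (suc l) {g = seq γ k}
      (subst (1ℚ ≤_) S≡L (1≤S k 3≤l))
      L≤H
      (subst (λ t → H (suc l) ≤ t + 1ℚ) S≡L (H≤S+1 l k))
      (subst (λ t → ∣ seq γ k - (H (suc l) - t) ∣ ≤ fromℕ 4 * u l) S≡L (γ-close l k l≤k))
      4uL≤4
      public

  -- Passage from approximants to real numbers

  β-one-log : ∀ n .{{_ : ℕ.NonTrivial n}} → 4 ℕ.≤ n →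
    ∣ fromℚ (β 1 n) -ℝ (log^ (+ 1) n +ℝ γ *ℝ fromℚ (fromℕ 1) *ℝ log^ (+ 0) n) ∣ℝ
      ≤ℝ fromℚ (fromℕ 4) *ℝ log^ ℤ.-1ℤ n
  β-one-log (suc zero)    (ℕ.s≤s ())
  β-one-log (suc (suc l)) (ℕ.s≤s 3≤l) ε 0<ε = suc l , λ k l≤k →
    ≤-trans (LogEstimate.estimate-one 3≤l l≤k) (p≤p+q (<⇒≤ 0<ε))

  β-suc-suc-log : ∀ m n .{{_ : ℕ.NonTrivial n}} → 4 ℕ.≤ n →
    ∣ fromℚ (β (suc (suc m)) n) -ℝ
      (log^ (+ suc (suc m)) n +ℝ γ *ℝ fromℚ (fromℕ (suc (suc m))) *ℝ log^ (+ suc m) n) ∣ℝ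
      ≤ℝ fromℚ (errorConst m) *ℝ log^ (+ m) n
  β-suc-suc-log m (suc zero)        (ℕ.s≤s ())
  β-suc-suc-log m (suc l@(suc _))   (ℕ.s≤s 3≤l) ε 0<ε = l , λ k l≤k →
    -- A real power with a variable exponent does not reduce, so the approximants of the powers are
    -- rewritten as powers of the approximant.
    let pow : ∀ i → seq (log (suc l)) k ^ i ≡ seq (log (suc l) ^ℝ i) k
        pow i = sym (seq-^ℝ (log (suc l)) i k)
    in ≤-trans
      (subst₂ _≤_
        (cong₂ (λ x y → ∣ β (suc (suc m)) (suc l) - (x + seq γ k * fromℕ (suc (suc m)) * y) ∣)
               (pow (suc (suc m))) (pow (suc m)))
        (cong (errorConst m *_) (pow m))
        (LogEstimate.estimate 3≤l l≤k m))
      (p≤p+q (<⇒≤ 0<ε))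

open import Data.Integer.Base using (_-_)
open import Data.Nat.Base using (_≤_; NonTrivial)

theorem2p2 : ∀ (s : ℕ) → 1 ≤ s →
    ∃ λ (K : ℝ) → ∃ λ (N : ℕ) → ∀ (n : ℕ) → .{{_ : NonTrivial n}} → N ≤ n →
    ∣ fromℚ (β s n) -ℝ (log^ (+ s) n +ℝ γ *ℝ fromℚ (fromℕ s) *ℝ log^ (+ s - + 1) n) ∣ℝ
    ≤ℝ K *ℝ log^ (+ s - + 2) n
-- At s = 1 the error exponent is -1 and the error term a reciprocal; for s ≥ 2 all exponents
-- compute to natural numbers.
theorem2p2 1             _ = fromℚ (fromℕ 4) , 4 , β-one-log
theorem2p2 (suc (suc m)) _ = fromℚ (errorConst m) , 4 , β-suc-suc-log m
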